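{- Let $\mathcal{A}$ be a finite list of elements of $\Gamma=\mathbb{Z}^\ell$ and let $k$ be a positive divisor of $\rho_{\mathcal{A}}$. Then the $k$-constituent of the characteristic quasi-polynomial of $\mathcal{A}$, i.e. the polynomial $f_k(t)$ such that $f_k(q)=\#\mathcal{M}(\mathcal{A};\mathbb{Z}^\ell,\mathbb{Z}/q\mathbb{Z})$ for every positive integer $q\equiv k\pmod{\rho_{\mathcal{A}}}$, satisfies $$f_k(t)=\chi^{\mathbb{Z}/k\mathbb{Z}}_{\mathcal{A}}(t).$$
   Context: $\mathcal{M}(\mathcal{A};\mathbb{Z}^\ell,G)=\mathrm{Hom}(\mathbb{Z}^\ell,G)\smallsetminus\bigcup_{\alpha\in\mathcal{A}}\{\varphi\mid\varphi(\alpha)=0\}\cong\{x\in G^\ell\mid \alpha(x)\ne0\ \forall\alpha\in\mathcal{A}\}$. For a sublist $\mathcal{S}$ (sublists distinguished by index), write $(\mathbb{Z}^\ell/\langle\mathcal{S}\rangle)_{\mathrm{tor}}\simeq\bigoplus_i\mathbb{Z}/d_{\mathcal{S},i}\mathbb{Z}$ with $d_{\mathcal{S},i}\mid d_{\mathcal{S},i+1}$; $\rho_{\mathcal{A}}$ is the lcm of the largest such $d_{\mathcal{S},i}$ over all $\mathcal{S}\subset\mathcal{A}$. It is known (Kamiya–Takemura–Terao) that $q\mapsto\#\mathcal{M}(\mathcal{A};\mathbb{Z}^\ell,\mathbb{Z}/q\mathbb{Z})$ is a quasi-polynomial with period $\rho_{\mathcal{A}}$, so the polynomials $f_k$ exist.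 $r_{\mathcal{S}}$ is the rank of $\langle\mathcal{S}\rangle$, $m(\mathcal{S};G)=\#\mathrm{Hom}((\mathbb{Z}^\ell/\langle\mathcal{S}\rangle)_{\mathrm{tor}},G)$ and $\chi^G_{\mathcal{A}}(t)=\sum_{\mathcal{S}\subset\mathcal{A}}(-1)^{\#\mathcal{S}}m(\mathcal{S};G)t^{\ell-r_{\mathcal{S}}}$. -}

module Defs where

open import Algebra.Bundles using (AbelianGroup)
import Algebra.Construct.DirectProduct as DirectProduct
import Algebra.Construct.Pointwise as Pointwise
import Algebra.Construct.Terminal as Terminal
import Algebra.Definitions.RawMonoid as RawMonoidDefinitions
open import Algebra.Morphism.Bundles using (GroupHomomorphism)
open import Algebra.Morphism.Structures using (IsGroupIsomorphism)
import Algebra.Properties.AbelianGroup as AbelianGroupProperties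
import Algebra.Properties.CommutativeMonoid.Mult as MultProperties
open import Data.Fin.Base using (Fin)
open import Data.Fin.Subset using (Subset; inside; outside; ∣_∣)
  renaming (_∈_ to _∈ˢ_)
open import Data.Integer.Base as ℤ using (ℤ; +_; 0ℤ; 1ℤ)
import Data.Integer.Properties as ℤ
open import Data.Integer.Divisibility.Signed as ℤ∣ using ()
  renaming (_∣_ to _∣ℤ_)
open import Data.List.Base
  using (List; []; _∷_; [_]; _++_; foldr; length; lookup; map; replicate)
open import Data.List.Extrema.Nat using (max)
open import Data.List.Relation.Unary.All using (All)
open import Data.List.Relation.Unary.Linked using (Linked)
open import Data.Nat.Base as ℕ using (ℕ; zero; suc; _∸_; NonZero; ∣_-_∣)
import Data.Nat.Properties as ℕ
open import Data.Nat.Divisibility using (_∣_)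
open import Data.Nat.LCM using (lcm)
open import Data.Product.Base using (Σ; Σ-syntax; ∃-syntax; _×_; _,_; proj₁; proj₂)
open import Data.Rational.Base as ℚ using (ℚ; 0ℚ)
import Data.Vec.Base as Vec
open import Function.Bundles using (Inverse)
open import Level using (0ℓ)
open import Relation.Binary.Bundles using (Setoid)
open import Relation.Binary.PropositionalEquality
  using (_≡_; refl; sym; cong; subst; setoid)
open import Relation.Nullary.Negation using (¬_)
open import Relation.Unary using (Pred)

open AbelianGroup using (Carrier)

Ab : Set₁
Ab = AbelianGroup 0ℓ 0ℓ

------------------------------------------------------------------------
-- Cardinality of a setoid (number of equivalence classes)

_HasCardinality_ : Setoid 0ℓ 0ℓ → ℕ → Set
X HasCardinality N = Inverse X (setoid (Fin N))

------------------------------------------------------------------------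
-- Abelian groups

Hom : Ab → Ab → Set
Hom G H = GroupHomomorphism (AbelianGroup.rawGroup G) (AbelianGroup.rawGroup H)

HomSetoid : Ab → Ab → Setoid 0ℓ 0ℓ
HomSetoid G H = record
  { Carrier       = Hom G H
  ; _≈_           = λ φ ψ → ∀ x → ⟦ φ ⟧ x H.≈ ⟦ ψ ⟧ x
  ; isEquivalence = record
    { refl  = λ x → H.refl
    ; sym   = λ p x → H.sym (p x)
    ; trans = λ p q x → H.trans (p x) (q x)
    }
  }
  where
  open GroupHomomorphism using (⟦_⟧)
  module H = AbelianGroup H

_≅_ : Ab → Ab → Set
G ≅ H = Σ[ f ∈ (Carrier G → Carrier H) ]
  IsGroupIsomorphism (AbelianGroup.rawGroup G) (AbelianGroup.rawGroup H) f

module _ (G : Ab) where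
  open AbelianGroup G renaming (Carrier to ∣G∣)
  open RawMonoidDefinitions rawMonoid using () renaming (_×_ to _·_)
  open AbelianGroupProperties G
    using (⁻¹-anti-homo-//; ⁻¹-∙-comm; ε⁻¹≈ε)
  open MultProperties commutativeMonoid
    using (×-congʳ; ×-assocˡ; ×-distrib-+)
  open import Relation.Binary.Reasoning.Setoid (AbelianGroup.setoid G)

  data Generated (P : Pred ∣G∣ 0ℓ) : Pred ∣G∣ 0ℓ where
    gen  : ∀ {x} → P x → Generated P x
    ε∈   : Generated P ε
    ∙∈   : ∀ {x y} → Generated P x → Generated P y → Generated P (x ∙ y)
    ⁻¹∈  : ∀ {x} → Generated P x → Generated P (x ⁻¹)
    resp : ∀ {x y} → x ≈ y → Generated P x → Generated P y

  generatedSubgroup : Pred ∣G∣ 0ℓ → Ab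
  generatedSubgroup P = record
    { Carrier = Σ ∣G∣ (Generated P)
    ; _≈_     = λ x y → proj₁ x ≈ proj₁ y
    ; _∙_     = λ x y → proj₁ x ∙ proj₁ y , ∙∈ (proj₂ x) (proj₂ y)
    ; ε       = ε , ε∈
    ; _⁻¹     = λ x → proj₁ x ⁻¹ , ⁻¹∈ (proj₂ x)
    ; isAbelianGroup = record
      { isGroup = record
        { isMonoid = record
          { isSemigroup = record
            { isMagma = record
              { isEquivalence = record
                { refl = AbelianGroup.refl G
                ; sym = AbelianGroup.sym G
                ; trans = trans
                }
              ; ∙-cong = ∙-cong
              }
            ; assoc = λ x y z → assoc (proj₁ x) (proj₁ y) (proj₁ z)
            }
          ; identity = (λ x → identityˡ (proj₁ x)) , (λ x → identityʳ (proj₁ x))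
          }
        ; inverse = (λ x → inverseˡ (proj₁ x)) , (λ x → inverseʳ (proj₁ x))
        ; ⁻¹-cong = ⁻¹-cong
        }
      ; comm = λ x y → comm (proj₁ x) (proj₁ y)
      }
    }

  -- G / ⟨P⟩: the carrier of G, with x and y identified when x - y ∈ ⟨P⟩.
  quotient : Pred ∣G∣ 0ℓ → Ab
  quotient P = record
    { Carrier = ∣G∣
    ; _≈_     = _~_
    ; _∙_     = _∙_
    ; ε       = ε
    ; _⁻¹     = _⁻¹
    ; isAbelianGroup = record
      { isGroup = record
        { isMonoid = record
          { isSemigroup = record
            { isMagma = record
              { isEquivalence = record
                { refl  = ≈⇒~ (AbelianGroup.refl G)
                ; sym   = λ {x} {y} p → resp (⁻¹-anti-homo-// x y) (⁻¹∈ p)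
                ; trans = λ {x} {y} {z} p q → resp (telescope x y z) (∙∈ p q)
                }
              ; ∙-cong = λ {x} {y} {u} {v} p q →
                  resp (interchange x y u v) (∙∈ p q)
              }
            ; assoc = λ x y z → ≈⇒~ (assoc x y z)
            }
          ; identity = (λ x → ≈⇒~ (identityˡ x)) , (λ x → ≈⇒~ (identityʳ x))
          }
        ; inverse = (λ x → ≈⇒~ (inverseˡ x)) , (λ x → ≈⇒~ (inverseʳ x))
        ; ⁻¹-cong = λ {x} {y} p → resp (AbelianGroup.sym G (⁻¹-∙-comm x (y ⁻¹))) (⁻¹∈ p)
        }
      ; comm = λ x y → ≈⇒~ (comm x y)
      }
    }
    where
    _~_ : ∣G∣ → ∣G∣ → Set
    x ~ y = Generated P (x ∙ y ⁻¹)

    ≈⇒~ : ∀ {x y} → x ≈ y → x ~ y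
    ≈⇒~ {x} {y} x≈y = resp
      (AbelianGroup.sym G (trans (∙-congʳ x≈y) (inverseʳ y))) ε∈

    telescope : ∀ x y z → (x ∙ y ⁻¹) ∙ (y ∙ z ⁻¹) ≈ x ∙ z ⁻¹
    telescope x y z = begin
      (x ∙ y ⁻¹) ∙ (y ∙ z ⁻¹) ≈⟨ assoc x (y ⁻¹) (y ∙ z ⁻¹) ⟩
      x ∙ (y ⁻¹ ∙ (y ∙ z ⁻¹)) ≈⟨ ∙-congˡ (assoc (y ⁻¹) y (z ⁻¹)) ⟨
      x ∙ ((y ⁻¹ ∙ y) ∙ z ⁻¹) ≈⟨ ∙-congˡ (∙-congʳ (inverseˡ y)) ⟩
      x ∙ (ε ∙ z ⁻¹)          ≈⟨ ∙-congˡ (identityˡ (z ⁻¹)) ⟩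
      x ∙ z ⁻¹                ∎

    interchange : ∀ x y u v →
      (x ∙ y ⁻¹) ∙ (u ∙ v ⁻¹) ≈ (x ∙ u) ∙ (y ∙ v) ⁻¹
    interchange x y u v = begin
      (x ∙ y ⁻¹) ∙ (u ∙ v ⁻¹) ≈⟨ assoc x (y ⁻¹) (u ∙ v ⁻¹) ⟩
      x ∙ (y ⁻¹ ∙ (u ∙ v ⁻¹)) ≈⟨ ∙-congˡ (assoc (y ⁻¹) u (v ⁻¹)) ⟨
      x ∙ ((y ⁻¹ ∙ u) ∙ v ⁻¹) ≈⟨ ∙-congˡ (∙-congʳ (comm (y ⁻¹) u)) ⟩
      x ∙ ((u ∙ y ⁻¹) ∙ v ⁻¹) ≈⟨ ∙-congˡ (assoc u (y ⁻¹) (v ⁻¹)) ⟩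
      x ∙ (u ∙ (y ⁻¹ ∙ v ⁻¹)) ≈⟨ assoc x u (y ⁻¹ ∙ v ⁻¹) ⟨
      (x ∙ u) ∙ (y ⁻¹ ∙ v ⁻¹) ≈⟨ ∙-congˡ (⁻¹-∙-comm y v) ⟩
      (x ∙ u) ∙ (y ∙ v) ⁻¹    ∎

  IsTorsion : Pred ∣G∣ 0ℓ
  IsTorsion x = ∃[ m ] NonZero m × m · x ≈ ε

  torsionSubgroup : Ab
  torsionSubgroup = record
    { Carrier = Σ ∣G∣ IsTorsion
    ; _≈_     = λ x y → proj₁ x ≈ proj₁ y
    ; _∙_     = λ x y → proj₁ x ∙ proj₁ y , torsion-∙ (proj₂ x) (proj₂ y)
    ; ε       = ε , 1 , _ , identityʳ ε
    ; _⁻¹     = λ x → proj₁ x ⁻¹ , torsion-⁻¹ (proj₂ x)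
    ; isAbelianGroup = record
      { isGroup = record
        { isMonoid = record
          { isSemigroup = record
            { isMagma = record
              { isEquivalence = record
                { refl = AbelianGroup.refl G
                ; sym = AbelianGroup.sym G
                ; trans = trans
                }
              ; ∙-cong = ∙-cong
              }
            ; assoc = λ x y z → assoc (proj₁ x) (proj₁ y) (proj₁ z)
            }
          ; identity = (λ x → identityˡ (proj₁ x)) , (λ x → identityʳ (proj₁ x))
          }
        ; inverse = (λ x → inverseˡ (proj₁ x)) , (λ x → inverseʳ (proj₁ x))
        ; ⁻¹-cong = ⁻¹-cong
        }
      ; comm = λ x y → comm (proj₁ x) (proj₁ y)
      }
    }
    where
    ·-ε : ∀ m → m · ε ≈ ε
    ·-ε zero    = AbelianGroup.refl G
    ·-ε (suc m) = trans (identityˡ (m · ε)) (·-ε m)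

    multiple : ∀ m {n x} → n · x ≈ ε → (m ℕ.* n) · x ≈ ε
    multiple m {n} {x} nx≈ε = begin
      (m ℕ.* n) · x ≈⟨ ×-assocˡ x m n ⟨
      m · (n · x)   ≈⟨ ×-congʳ m nx≈ε ⟩
      m · ε         ≈⟨ ·-ε m ⟩
      ε             ∎

    torsion-∙ : ∀ {x y} → IsTorsion x → IsTorsion y → IsTorsion (x ∙ y)
    torsion-∙ {x} {y} (m , m≢0 , mx≈ε) (n , n≢0 , ny≈ε) =
      m ℕ.* n , ℕ.m*n≢0 m n {{m≢0}} {{n≢0}} , (begin
        (m ℕ.* n) · (x ∙ y)               ≈⟨ ×-distrib-+ x y (m ℕ.* n) ⟩
        (m ℕ.* n) · x ∙ (m ℕ.* n) · y     ≡⟨ cong (λ k → k · x ∙ (m ℕ.* n) · y) (ℕ.*-comm m n) ⟩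
        (n ℕ.* m) · x ∙ (m ℕ.* n) · y     ≈⟨ ∙-cong (multiple n mx≈ε) (multiple m ny≈ε) ⟩
        ε ∙ ε                             ≈⟨ identityˡ ε ⟩
        ε                                 ∎)

    ·-⁻¹ : ∀ m x → m · (x ⁻¹) ≈ (m · x) ⁻¹
    ·-⁻¹ zero    x = AbelianGroup.sym G ε⁻¹≈ε
    ·-⁻¹ (suc m) x = trans (∙-congˡ (·-⁻¹ m x)) (⁻¹-∙-comm x (m · x))

    torsion-⁻¹ : ∀ {x} → IsTorsion x → IsTorsion (x ⁻¹)
    torsion-⁻¹ {x} (m , m≢0 , mx≈ε) =
      m , m≢0 , trans (·-⁻¹ m x) (trans (⁻¹-cong mx≈ε) ε⁻¹≈ε)

ℤ^_ : ℕ → Ab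
ℤ^ ℓ = Pointwise.abelianGroup (Fin ℓ) ℤ.+-0-abelianGroup

-- The integers, with x and y identified when d divides x - y.
ℤ/_ : ℕ → Ab
ℤ/ d = record
  { Carrier = ℤ
  ; _≈_     = _~_
  ; _∙_     = ℤ._+_
  ; ε       = 0ℤ
  ; _⁻¹     = ℤ.-_
  ; isAbelianGroup = record
    { isGroup = record
      { isMonoid = record
        { isSemigroup = record
          { isMagma = record
            { isEquivalence = record
              { refl  = λ {x} → ≡⇒~ {x} refl
              ; sym   = λ {x} {y} p → subst (+ d ∣ℤ_) (negate x y) (ℤ∣.∣m⇒∣-m p)
              ; trans = λ {x} {y} {z} p q →
                  subst (+ d ∣ℤ_) (telescope x y z) (ℤ∣.∣m∣n⇒∣m+n p q)
              }
            ; ∙-cong = λ {x} {y} {u} {v} p q →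
                subst (+ d ∣ℤ_) (interchange x y u v) (ℤ∣.∣m∣n⇒∣m+n p q)
            }
          ; assoc = λ x y z → ≡⇒~ (ℤ.+-assoc x y z)
          }
        ; identity = (λ x → ≡⇒~ (ℤ.+-identityˡ x)) , (λ x → ≡⇒~ (ℤ.+-identityʳ x))
        }
      ; inverse = (λ x → ≡⇒~ (ℤ.+-inverseˡ x)) , (λ x → ≡⇒~ (ℤ.+-inverseʳ x))
      ; ⁻¹-cong = λ {x} {y} p →
          subst (+ d ∣ℤ_) (ℤ.neg-distrib-+ x (ℤ.- y)) (ℤ∣.∣m⇒∣-m p)
      }
    ; comm = λ x y → ≡⇒~ (ℤ.+-comm x y)
    }
  }
  where
  open import Data.Integer.Tactic.RingSolver using (solve-∀)

  _~_ : ℤ → ℤ → Set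
  x ~ y = + d ∣ℤ x ℤ.- y

  ≡⇒~ : ∀ {x y} → x ≡ y → x ~ y
  ≡⇒~ {x} refl = subst (+ d ∣ℤ_) (sym (ℤ.+-inverseʳ x)) (ℤ∣.divides 0ℤ refl)

  negate : ∀ x y → ℤ.- (x ℤ.- y) ≡ y ℤ.- x
  negate = solve-∀

  telescope : ∀ x y z → (x ℤ.- y) ℤ.+ (y ℤ.- z) ≡ x ℤ.- z
  telescope = solve-∀

  interchange : ∀ x y u v →
    (x ℤ.- y) ℤ.+ (u ℤ.- v) ≡ (x ℤ.+ u) ℤ.- (y ℤ.+ v)
  interchange = solve-∀

⨁ℤ/_ : List ℕ → Ab
⨁ℤ/ []       = Terminal.abelianGroup
⨁ℤ/ (d ∷ ds) = DirectProduct.abelianGroup (ℤ/ d) (⨁ℤ/ ds)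

record InvariantFactors (G : Ab) (ds : List ℕ) : Set where
  field
    positive       : All NonZero ds
    divisibility   : Linked _∣_ ds
    decomposition  : G ≅ (⨁ℤ/ ds)

------------------------------------------------------------------------
-- Polynomials over ℚ, as lists of coefficients in increasing degree.
-- Trailing zeros are allowed, so equality is _≋_ rather than _≡_.

Polynomial : Set
Polynomial = List ℚ

coeff : Polynomial → ℕ → ℚ
coeff []      _       = 0ℚ
coeff (a ∷ p) zero    = a
coeff (a ∷ p) (suc j) = coeff p j

infix 4 _≋_
_≋_ : Polynomial → Polynomial → Set
p ≋ q = ∀ j → coeff p j ≡ coeff q j

eval : Polynomial → ℚ → ℚ
eval p t = foldr (λ a y → a ℚ.+ t ℚ.* y) 0ℚ p

infixl 6 _+ᴾ_
_+ᴾ_ : Polynomial → Polynomial → Polynomial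
[]      +ᴾ q       = q
(a ∷ p) +ᴾ []      = a ∷ p
(a ∷ p) +ᴾ (b ∷ q) = (a ℚ.+ b) ∷ (p +ᴾ q)

-- monomial c e is c tᵉ.
monomial : ℚ → ℕ → Polynomial
monomial c e = replicate e 0ℚ ++ [ c ]

ℤ→ℚ : ℤ → ℚ
ℤ→ℚ i = i ℚ./ 1

------------------------------------------------------------------------
-- Arrangements

allSubsets : ∀ n → List (Subset n)
allSubsets zero    = [ Vec.[] ]
allSubsets (suc n) =
  map (outside Vec.∷_) (allSubsets n) ++ map (inside Vec.∷_) (allSubsets n)

module _ {ℓ : ℕ} (A : List (Carrier (ℤ^ ℓ))) where

  -- Sublists are sets of positions: repeated vectors are told apart by index.
  Sublist : Set
  Sublist = Subset (length A)

  sublists : List Sublist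
  sublists = allSubsets (length A)

  Members : Sublist → Pred (Carrier (ℤ^ ℓ)) 0ℓ
  Members S v = ∃[ i ] (i ∈ˢ S × v ≡ lookup A i)

  ⟨_⟩ : Sublist → Ab
  ⟨ S ⟩ = generatedSubgroup (ℤ^ ℓ) (Members S)

  ℤ^ℓ/⟨_⟩-tor : Sublist → Ab
  ℤ^ℓ/⟨ S ⟩-tor = torsionSubgroup (quotient (ℤ^ ℓ) (Members S))

  -- ⟨S⟩ is free, being a subgroup of ℤ^ℓ; its rank is the size of a basis.
  HasRank : Sublist → ℕ → Set
  HasRank S r = ⟨ S ⟩ ≅ (ℤ^ r)

  -- The largest invariant factor of the trivial group (empty list) is 1.
  largest : List ℕ → ℕ
  largest ds = max 1 ds

  record IsLCMPeriod (ρ : ℕ) : Set where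
    field
      d                : Sublist → List ℕ
      invariantFactors : ∀ S → InvariantFactors ℤ^ℓ/⟨ S ⟩-tor (d S)
      isLCM            : ρ ≡ foldr lcm 1 (map (λ S → largest (d S)) sublists)

  -- ℳ(A; ℤ^ℓ, G) as a subset of Hom(ℤ^ℓ, G)
  ℳ : Ab → Setoid 0ℓ 0ℓ
  ℳ G = record
    { Carrier       = Σ[ φ ∈ Hom (ℤ^ ℓ) G ] ∀ i → ¬ (⟦ φ ⟧ (lookup A i) G.≈ G.ε)
    ; _≈_           = λ φ ψ → proj₁ φ H.≈ proj₁ ψ
    ; isEquivalence = record { refl = λ {φ} → H.refl {proj₁ φ}
                             ; sym = λ {φ} {ψ} → H.sym {proj₁ φ} {proj₁ ψ}
                             ; trans = λ {φ} {ψ} {θ} → H.trans {proj₁ φ} {proj₁ ψ} {proj₁ θ} }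
    }
    where
    open GroupHomomorphism using (⟦_⟧)
    module G = AbelianGroup G
    module H = Setoid (HomSetoid (ℤ^ ℓ) G)

  -- f is the k-constituent of q ↦ #ℳ(A; ℤ^ℓ, ℤ/q) with respect to the period ρ.
  IsConstituent : (ρ k : ℕ) → Polynomial → Set
  IsConstituent ρ k f = ∀ q → NonZero q → ρ ∣ ∣ q - k ∣ →
    ∃[ N ] (ℳ (ℤ/ q) HasCardinality N × eval f (ℤ→ℚ (+ q)) ≡ ℤ→ℚ (+ N))

  record CharacteristicData (G : Ab) : Set where
    field
      m    : Sublist → ℕ
      m-is : ∀ S → HomSetoid ℤ^ℓ/⟨ S ⟩-tor G HasCardinality m S
      r    : Sublist → ℕ
      r-is : ∀ S → HasRank S (r S)

    -- χ^G_A(t); the exponents use ∸, but r S ≤ ℓ always holds.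
    χ : Polynomial
    χ = foldr _+ᴾ_ [] (map term sublists)
      where
      term : Sublist → Polynomial
      term S = monomial (ℤ→ℚ ((ℤ.- 1ℤ) ℤ.^ ∣ S ∣ ℤ.* + m S)) (ℓ ∸ r S)

{-# OPTIONS --safe #-}

-- Inclusion–exclusion over the sublists S of A counts ℳ(A; ℤ^ℓ, ℤ/q) in terms of the numbers of
-- homomorphisms ℤ^ℓ → ℤ/q killing S.  The saturation of ⟨S⟩ is a direct summand of ℤ^ℓ with free
-- complement of rank ℓ - r_S, so that number is #Hom(tor, ℤ/q) q^(ℓ - r_S), where tor is the torsion
-- of ℤ^ℓ/⟨S⟩.  As ρ annihilates tor, for q ≡ k (mod ρ) the image of every tor → ℤ/q lies in the
-- k-torsion of ℤ/q, which is a copy of ℤ/k; hence #Hom(tor, ℤ/q) = m(S; ℤ/k).  Thus f_k and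
-- χ agree at the infinitely many q = k + jρ.
module Submission where

open import Defs
open import Algebra.Bundles using (AbelianGroup)
open import Algebra.Morphism.Construct.Composition using (isGroupHomomorphism)
open import Algebra.Morphism.Bundles using (GroupHomomorphism)
open import Algebra.Morphism.Structures using (IsGroupIsomorphism)
import Algebra.Definitions.RawMonoid as RawMonoidDefinitions
import Algebra.Properties.Group as GroupProperties
import Algebra.Properties.Semiring.Sum as SemiringSum
open import Data.Bool.Base using (Bool; true; false; _∧_; not)
open import Data.Fin.Base as Fin using (Fin; zero; suc)
import Data.Fin.Properties as Fin
open import Data.Fin.Permutation using (↔⇒≡)
open import Data.Fin.Subset using (Subset; inside; outside; ∣_∣)
  renaming (_∈_ to _∈ˢ_)
open import Data.Integer.Base as ℤ using (ℤ; +_; -[1+_]; 0ℤ; 1ℤ)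
import Data.Integer.Properties as ℤ
import Data.Integer.DivMod as ℤ
open import Data.Integer.Divisibility.Signed as ℤ∣ using ()
  renaming (_∣_ to _∣ℤ_)
import Data.Integer.Tactic.RingSolver as ℤ-Solver
open import Data.List.Base using (List; []; _∷_; _++_; foldr; length; lookup; map)
open import Data.List.Membership.Propositional using (_∈_)
open import Data.List.Membership.Propositional.Properties using (∈-map⁺; ∈-++⁺ˡ; ∈-++⁺ʳ)
open import Data.List.Extrema.Nat using (max; argmax-sel; xs≤max; ⊥≤max)
open import Data.List.Relation.Unary.All as All using (All; []; _∷_)
open import Data.List.Relation.Unary.All.Properties using (map⁺)
open import Data.List.Relation.Unary.AllPairs using (AllPairs; []; _∷_)
open import Data.List.Relation.Unary.Any using (here; there)
open import Data.List.Relation.Unary.Linked using (Linked)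
open import Data.List.Relation.Unary.Linked.Properties using (Linked⇒AllPairs)
open import Data.Nat.Base as ℕ using (ℕ; zero; suc; _∸_; NonZero)
import Data.Nat.Properties as ℕ
open import Data.Nat.Divisibility as ℕ∣ using (_∣_; divides)
open import Data.Nat.Induction using (<-wellFounded)
open import Data.Nat.LCM using (lcm; m∣lcm[m,n]; n∣lcm[m,n]; gcd*lcm)
open import Data.Nat.GCD using (gcd)
open import Data.Product.Base using (Σ; Σ-syntax; ∃-syntax; _×_; _,_; proj₁; proj₂)
open import Data.Product.Relation.Binary.Pointwise.NonDependent using (×-setoid)
open import Data.Rational.Base as ℚ using (ℚ; 0ℚ)
import Data.Rational.Properties as ℚ
import Data.Rational.Solver as ℚ-Solver
import Data.Rational.Unnormalised.Base as ℚᵘ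
import Data.Rational.Unnormalised.Properties as ℚᵘ
open import Data.Sum.Base using (_⊎_; inj₁; inj₂; [_,_]′)
open import Data.Vec.Base using ([]; _∷_) renaming (here to hereⱽ; there to thereⱽ)
open import Data.Vec.Functional using () renaming (_∷_ to _∷ᶠ_; _++_ to _++ᶠ_)
open import Data.Vec.Functional.Properties using (lookup-++ˡ; lookup-++ʳ)
open import Data.Vec.Functional.Relation.Binary.Equality.Setoid using (≋-setoid)
open import Function.Base using (_∘_; id)
open import Function.Bundles using (Inverse)
import Function.Construct.Composition as Composition
import Function.Construct.Symmetry as Symmetry
open import Induction.WellFounded using (Acc; acc)
open import Level using (0ℓ)
open import Relation.Binary.Bundles using (Setoid)
open import Relation.Binary.PropositionalEquality
  using (_≡_; _≢_; refl; sym; trans; cong; cong₂; subst; subst₂; setoid; module ≡-Reasoning)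
open import Relation.Nullary.Decidable using (Dec; yes; no; does; map′; ¬?; _×-dec_)
open import Relation.Nullary.Negation using (¬_; contradiction)
open import Relation.Unary using (Pred)

open SemiringSum ℤ.+-*-semiring using (sum; sum-cong-≗; sum-replicate-zero; ∑-distrib-+; *-distribˡ-sum)
open GroupHomomorphism using (⟦_⟧)

-- Polynomials over ℚ

-- The numbers `m S`, `r S` and the size of `ℳ` are certified only by bijections and isomorphisms,
-- so nothing can be read off from them. Each is matched with a count obtained independently: by
-- uniqueness of cardinality, or, for the rank, by injections of free groups in both directions. The
-- saturation is built by adjoining the members of S one at a time, each straightened by Euclid's
-- algorithm. The structure of tor enters only through its exponent: the largest invariant factor
-- annihilates tor, hence so does ρ. This uniform multiplier serves twice. It forces the images of
-- tor into the k-torsion of ℤ/q, and it turns the pointwise fact that some nonzero multiple of x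
-- lies in ⟨S⟩ into one homomorphism x ↦ ρ x from the saturation to ⟨S⟩, which the comparison of
-- ranks requires. The divisibility of ρ by k enters through the sample points: if ρ = d k, then q =
-- k + jρ = (1 + j d) k is a multiple of k, and 1 + j d is the factor that embeds ℤ/k in ℤ/q.

ℤ→ℚ-injective : ∀ {i j} → ℤ→ℚ i ≡ ℤ→ℚ j → i ≡ j
ℤ→ℚ-injective {i} {j} eq with ℚ.fromℚᵘ-injective {ℚᵘ.mkℚᵘ i 0} {ℚᵘ.mkℚᵘ j 0} eq
... | ℚᵘ.*≡* p = trans (sym (ℤ.*-identityʳ i)) (trans p (ℤ.*-identityʳ j))

ℤ→ℚ-homo-+ : ∀ i j → ℤ→ℚ (i ℤ.+ j) ≡ ℤ→ℚ i ℚ.+ ℤ→ℚ j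
ℤ→ℚ-homo-+ i j = ℚ.toℚᵘ-injective (begin
  ℚ.toℚᵘ (ℤ→ℚ (i ℤ.+ j))                    ≈⟨ ℚ.toℚᵘ-fromℚᵘ (ℚᵘ.mkℚᵘ (i ℤ.+ j) 0) ⟩
  ℚᵘ.mkℚᵘ (i ℤ.+ j) 0                        ≈⟨ ℚᵘ.*≡* (expand i j) ⟩
  ℚᵘ.mkℚᵘ i 0 ℚᵘ.+ ℚᵘ.mkℚᵘ j 0               ≈⟨ ℚᵘ.+-cong (ℚ.toℚᵘ-fromℚᵘ (ℚᵘ.mkℚᵘ i 0)) (ℚ.toℚᵘ-fromℚᵘ (ℚᵘ.mkℚᵘ j 0)) ⟨
  ℚ.toℚᵘ (ℤ→ℚ i) ℚᵘ.+ ℚ.toℚᵘ (ℤ→ℚ j)       ≈⟨ ℚ.toℚᵘ-homo-+ (ℤ→ℚ i) (ℤ→ℚ j) ⟨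
  ℚ.toℚᵘ (ℤ→ℚ i ℚ.+ ℤ→ℚ j)                 ∎)
  where
  open import Relation.Binary.Reasoning.Setoid ℚᵘ.≃-setoid
  expand : ∀ i j → (i ℤ.+ j) ℤ.* 1ℤ ≡ (i ℤ.* 1ℤ ℤ.+ j ℤ.* 1ℤ) ℤ.* 1ℤ
  expand = ℤ-Solver.solve-∀

ℤ→ℚ-homo-* : ∀ i j → ℤ→ℚ (i ℤ.* j) ≡ ℤ→ℚ i ℚ.* ℤ→ℚ j
ℤ→ℚ-homo-* i j = ℚ.toℚᵘ-injective (begin
  ℚ.toℚᵘ (ℤ→ℚ (i ℤ.* j))                    ≈⟨ ℚ.toℚᵘ-fromℚᵘ (ℚᵘ.mkℚᵘ (i ℤ.* j) 0) ⟩
  ℚᵘ.mkℚᵘ i 0 ℚᵘ.* ℚᵘ.mkℚᵘ j 0               ≈⟨ ℚᵘ.*-cong (ℚ.toℚᵘ-fromℚᵘ (ℚᵘ.mkℚᵘ i 0)) (ℚ.toℚᵘ-fromℚᵘ (ℚᵘ.mkℚᵘ j 0)) ⟨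
  ℚ.toℚᵘ (ℤ→ℚ i) ℚᵘ.* ℚ.toℚᵘ (ℤ→ℚ j)       ≈⟨ ℚ.toℚᵘ-homo-* (ℤ→ℚ i) (ℤ→ℚ j) ⟨
  ℚ.toℚᵘ (ℤ→ℚ i ℚ.* ℤ→ℚ j)                 ∎)
  where open import Relation.Binary.Reasoning.Setoid ℚᵘ.≃-setoid

x*y≡0⇒y≡0 : ∀ {x y} → x ≢ 0ℚ → x ℚ.* y ≡ 0ℚ → y ≡ 0ℚ
x*y≡0⇒y≡0 {x} {y} x≢0 xy≡0 = begin
  y                         ≡⟨ ℚ.*-identityˡ y ⟨
  ℚ.1ℚ ℚ.* y                ≡⟨ cong (ℚ._* y) (ℚ.*-inverseˡ x) ⟨
  (ℚ.1/ x ℚ.* x) ℚ.* y      ≡⟨ ℚ.*-assoc (ℚ.1/ x) x y ⟩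
  ℚ.1/ x ℚ.* (x ℚ.* y)      ≡⟨ cong (ℚ.1/ x ℚ.*_) xy≡0 ⟩
  ℚ.1/ x ℚ.* 0ℚ             ≡⟨ ℚ.*-zeroʳ (ℚ.1/ x) ⟩
  0ℚ                        ∎
  where
  open ≡-Reasoning
  instance x-nonZero = ℚ.≢-nonZero x≢0

eval-≋[] : ∀ p t → p ≋ [] → eval p t ≡ 0ℚ
eval-≋[] []      t p≋[] = refl
eval-≋[] (a ∷ p) t p≋[] = begin
  a ℚ.+ t ℚ.* eval p t ≡⟨ cong₂ (λ b y → b ℚ.+ t ℚ.* y) (p≋[] 0) (eval-≋[] p t (p≋[] ∘ suc)) ⟩
  0ℚ ℚ.+ t ℚ.* 0ℚ      ≡⟨ trans (ℚ.+-identityˡ _) (ℚ.*-zeroʳ t) ⟩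
  0ℚ                   ∎
  where open ≡-Reasoning

≋[]-∷ : ∀ {a p} t → eval (a ∷ p) t ≡ 0ℚ → p ≋ [] → (a ∷ p) ≋ []
≋[]-∷ {a} {p} t root p≋[] (suc j) = p≋[] j
≋[]-∷ {a} {p} t root p≋[] zero    = begin
  a                    ≡⟨ ℚ.+-identityʳ a ⟨
  a ℚ.+ 0ℚ             ≡⟨ cong (a ℚ.+_) (ℚ.*-zeroʳ t) ⟨
  a ℚ.+ t ℚ.* 0ℚ       ≡⟨ cong (λ y → a ℚ.+ t ℚ.* y) (eval-≋[] p t p≋[]) ⟨
  a ℚ.+ t ℚ.* eval p t ≡⟨ root ⟩
  0ℚ                   ∎
  where open ≡-Reasoning

-- horner c p is the quotient of a + t p(t) by t - c, for every constant a.
horner : ℚ → Polynomial → Polynomial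
horner c []      = []
horner c (a ∷ p) = eval (a ∷ p) c ∷ horner c p

length-horner : ∀ c p → length (horner c p) ≡ length p
length-horner c []      = refl
length-horner c (a ∷ p) = cong suc (length-horner c p)

-- The constant a of a + t p(t) cancels in the difference of its values at t and at c, which is the
-- right-hand side.
eval-horner : ∀ c p t →
  (t ℚ.- c) ℚ.* eval (horner c p) t ≡ t ℚ.* eval p t ℚ.- c ℚ.* eval p c
eval-horner c []      t = solve 2 (λ t c → (t :- c) :* con 0ℚ := t :* con 0ℚ :- c :* con 0ℚ) refl t c
  where open ℚ-Solver.+-*-Solver
eval-horner c (a ∷ p) t = begin
  (t ℚ.- c) ℚ.* (a ℚ.+ c ℚ.* y ℚ.+ t ℚ.* h)
    ≡⟨ solve 5 (λ t c a y h → (t :- c) :* (a :+ c :* y :+ t :* h) := (t :- c) :* (a :+ c :* y) :+ t :* ((t :- c) :* h)) refl t c a y h ⟩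
  (t ℚ.- c) ℚ.* (a ℚ.+ c ℚ.* y) ℚ.+ t ℚ.* ((t ℚ.- c) ℚ.* h)
    ≡⟨ cong (λ z → (t ℚ.- c) ℚ.* (a ℚ.+ c ℚ.* y) ℚ.+ t ℚ.* z) (eval-horner c p t) ⟩
  (t ℚ.- c) ℚ.* (a ℚ.+ c ℚ.* y) ℚ.+ t ℚ.* (t ℚ.* x ℚ.- c ℚ.* y)
    ≡⟨ solve 5 (λ t c a x y → (t :- c) :* (a :+ c :* y) :+ t :* (t :* x :- c :* y) := t :* (a :+ t :* x) :- c :* (a :+ c :* y)) refl t c a x y ⟩
  t ℚ.* (a ℚ.+ t ℚ.* x) ℚ.- c ℚ.* (a ℚ.+ c ℚ.* y) ∎
  where
  open ≡-Reasoning
  open ℚ-Solver.+-*-Solver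
  x = eval p t
  y = eval p c
  h = eval (horner c p) t

-- The entries of `horner c p` are the values at c of the successive tails of p. Read from the last
-- entry back, each one that vanishes forces one more coefficient to vanish.
horner-≋[] : ∀ c p → horner c p ≋ [] → p ≋ []
horner-≋[] c []      _    = λ _ → refl
horner-≋[] c (a ∷ p) h≋[] = ≋[]-∷ c (h≋[] 0) (horner-≋[] c p (h≋[] ∘ suc))

-- Dividing out the root `t 0` leaves a quotient that vanishes at all later `t j`, since these
-- differ from `t 0`. The quotient is not a subterm, so the recursion runs on the length `n`.
infinitely-many-roots : ∀ n p → length p ≡ n → (t : ℕ → ℚ) →
  (∀ {i j} → t i ≡ t j → i ≡ j) → (∀ j → eval p (t j) ≡ 0ℚ) → p ≋ []
infinitely-many-roots n       []      _   t t-inj roots = λ _ → refl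
infinitely-many-roots (suc n) (a ∷ p) len t t-inj roots =
  ≋[]-∷ c (roots 0) (horner-≋[] c p
    (infinitely-many-roots n (horner c p) (trans (length-horner c p) (ℕ.suc-injective len))
      (t ∘ suc) (ℕ.suc-injective ∘ t-inj)
      (λ j → x*y≡0⇒y≡0 (t-c≢0 j) (trans (eval-horner c p (t (suc j))) (difference j)))))
  where
  open ≡-Reasoning
  c = t 0
  t-c≢0 : ∀ j → t (suc j) ℚ.- c ≢ 0ℚ
  t-c≢0 j eq with t-inj {suc j} {0} (GroupProperties.x∙y⁻¹≈ε⇒x≈y ℚ.+-0-group _ _ eq)
  ... | ()
  difference : ∀ j → t (suc j) ℚ.* eval p (t (suc j)) ℚ.- c ℚ.* eval p c ≡ 0ℚ
  difference j = begin
    s ℚ.* x ℚ.- c ℚ.* y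
      ≡⟨ solve 5 (λ s x c y a → s :* x :- c :* y := (a :+ s :* x) :- (a :+ c :* y)) refl s x c y a ⟩
    (a ℚ.+ s ℚ.* x) ℚ.- (a ℚ.+ c ℚ.* y)
      ≡⟨ cong₂ ℚ._-_ (roots (suc j)) (roots 0) ⟩
    0ℚ ∎
    where
    open ℚ-Solver.+-*-Solver
    s = t (suc j)
    x = eval p s
    y = eval p c

eval-+ᴾ : ∀ p q t → eval (p +ᴾ q) t ≡ eval p t ℚ.+ eval q t
eval-+ᴾ []      q       t = sym (ℚ.+-identityˡ _)
eval-+ᴾ (a ∷ p) []      t = sym (ℚ.+-identityʳ _)
eval-+ᴾ (a ∷ p) (b ∷ q) t = trans
  (cong (λ y → a ℚ.+ b ℚ.+ t ℚ.* y) (eval-+ᴾ p q t))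
  (solve 5 (λ a b t x y → a :+ b :+ t :* (x :+ y) := (a :+ t :* x) :+ (b :+ t :* y)) refl a b t (eval p t) (eval q t))
  where open ℚ-Solver.+-*-Solver

coeff-+ᴾ : ∀ p q j → coeff (p +ᴾ q) j ≡ coeff p j ℚ.+ coeff q j
coeff-+ᴾ []      q       j       = sym (ℚ.+-identityˡ _)
coeff-+ᴾ (a ∷ p) []      j       = sym (ℚ.+-identityʳ _)
coeff-+ᴾ (a ∷ p) (b ∷ q) zero    = refl
coeff-+ᴾ (a ∷ p) (b ∷ q) (suc j) = coeff-+ᴾ p q j

-ᴾ_ : Polynomial → Polynomial
-ᴾ_ = map (ℚ.-_)

eval--ᴾ : ∀ p t → eval (-ᴾ p) t ≡ ℚ.- eval p t
eval--ᴾ []      t = refl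
eval--ᴾ (a ∷ p) t = trans (cong (λ y → ℚ.- a ℚ.+ t ℚ.* y) (eval--ᴾ p t))
  (solve 3 (λ a t x → :- a :+ t :* (:- x) := :- (a :+ t :* x)) refl a t (eval p t))
  where open ℚ-Solver.+-*-Solver

coeff--ᴾ : ∀ p j → coeff (-ᴾ p) j ≡ ℚ.- coeff p j
coeff--ᴾ []      j       = refl
coeff--ᴾ (a ∷ p) zero    = refl
coeff--ᴾ (a ∷ p) (suc j) = coeff--ᴾ p j

agreement⇒≋ : ∀ p q (t : ℕ → ℚ) → (∀ {i j} → t i ≡ t j → i ≡ j) →
  (∀ j → eval p (t j) ≡ eval q (t j)) → p ≋ q
agreement⇒≋ p q t t-inj agree j = GroupProperties.x∙y⁻¹≈ε⇒x≈y ℚ.+-0-group _ _ (begin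
  coeff p j ℚ.- coeff q j      ≡⟨ cong (coeff p j ℚ.+_) (coeff--ᴾ q j) ⟨
  coeff p j ℚ.+ coeff (-ᴾ q) j ≡⟨ coeff-+ᴾ p (-ᴾ q) j ⟨
  coeff (p +ᴾ (-ᴾ q)) j        ≡⟨ infinitely-many-roots _ (p +ᴾ (-ᴾ q)) refl t t-inj roots j ⟩
  0ℚ                           ∎)
  where
  open ≡-Reasoning
  roots : ∀ i → eval (p +ᴾ (-ᴾ q)) (t i) ≡ 0ℚ
  roots i = begin
    eval (p +ᴾ (-ᴾ q)) (t i)                ≡⟨ eval-+ᴾ p (-ᴾ q) (t i) ⟩
    eval p (t i) ℚ.+ eval (-ᴾ q) (t i)      ≡⟨ cong₂ ℚ._+_ (agree i) (eval--ᴾ q (t i)) ⟩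
    eval q (t i) ℚ.- eval q (t i)           ≡⟨ ℚ.+-inverseʳ (eval q (t i)) ⟩
    0ℚ                                      ∎

eval-monomial : ∀ c e n → eval (monomial (ℤ→ℚ c) e) (ℤ→ℚ (+ n)) ≡ ℤ→ℚ (c ℤ.* + (n ℕ.^ e))
eval-monomial c zero    n = begin
  ℤ→ℚ c ℚ.+ ℤ→ℚ (+ n) ℚ.* 0ℚ ≡⟨ cong (ℤ→ℚ c ℚ.+_) (ℚ.*-zeroʳ (ℤ→ℚ (+ n))) ⟩
  ℤ→ℚ c ℚ.+ 0ℚ               ≡⟨ ℚ.+-identityʳ (ℤ→ℚ c) ⟩
  ℤ→ℚ c                      ≡⟨ cong ℤ→ℚ (ℤ.*-identityʳ c) ⟨
  ℤ→ℚ (c ℤ.* 1ℤ)             ∎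
  where open ≡-Reasoning
eval-monomial c (suc e) n = begin
  0ℚ ℚ.+ ℤ→ℚ (+ n) ℚ.* eval (monomial (ℤ→ℚ c) e) (ℤ→ℚ (+ n))
    ≡⟨ ℚ.+-identityˡ _ ⟩
  ℤ→ℚ (+ n) ℚ.* eval (monomial (ℤ→ℚ c) e) (ℤ→ℚ (+ n))
    ≡⟨ cong (ℤ→ℚ (+ n) ℚ.*_) (eval-monomial c e n) ⟩
  ℤ→ℚ (+ n) ℚ.* ℤ→ℚ (c ℤ.* + (n ℕ.^ e))
    ≡⟨ ℤ→ℚ-homo-* (+ n) (c ℤ.* + (n ℕ.^ e)) ⟨
  ℤ→ℚ (+ n ℤ.* (c ℤ.* + (n ℕ.^ e)))
    ≡⟨ cong ℤ→ℚ (exchange (+ n) c (+ (n ℕ.^ e))) ⟩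
  ℤ→ℚ (c ℤ.* (+ n ℤ.* + (n ℕ.^ e)))
    ≡⟨ cong (λ y → ℤ→ℚ (c ℤ.* y)) (ℤ.pos-* n (n ℕ.^ e)) ⟨
  ℤ→ℚ (c ℤ.* + (n ℕ.^ suc e)) ∎
  where
  open ≡-Reasoning
  exchange : ∀ n c y → n ℤ.* (c ℤ.* y) ≡ c ℤ.* (n ℤ.* y)
  exchange = ℤ-Solver.solve-∀

-- Cardinalities of setoids

module _ {X Y : Setoid 0ℓ 0ℓ} where
  private
    module X = Setoid X
    module Y = Setoid Y

  mkInverse : (to : X.Carrier → Y.Carrier) (from : Y.Carrier → X.Carrier) →
    (∀ {x x′} → x X.≈ x′ → to x Y.≈ to x′) → (∀ {y y′} → y Y.≈ y′ → from y X.≈ from y′) →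
    (∀ y → to (from y) Y.≈ y) → (∀ x → from (to x) X.≈ x) → Inverse X Y
  mkInverse to from to-cong from-cong to∘from from∘to = record
    { to        = to
    ; from      = from
    ; to-cong   = to-cong
    ; from-cong = from-cong
    ; inverse   = (λ {y} x≈ → Y.trans (to-cong x≈) (to∘from y))
                , (λ {x} y≈ → X.trans (from-cong y≈) (from∘to x))
    }

module _ {X Y : Setoid 0ℓ 0ℓ} (e : Inverse X Y) where
  private
    module X = Setoid X
    module Y = Setoid Y
  open Inverse e

  to∘from : ∀ y → to (from y) Y.≈ y
  to∘from y = inverseˡ X.refl

  from∘to : ∀ x → from (to x) X.≈ x
  from∘to x = inverseʳ Y.refl

cardinality-unique : ∀ {X m n} → X HasCardinality m → X HasCardinality n → m ≡ n
cardinality-unique e e′ = ↔⇒≡ (Composition.inverse (Symmetry.inverse e) e′)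

cardinality-× : ∀ {X Y m n} → X HasCardinality m → Y HasCardinality n →
  (×-setoid X Y) HasCardinality (m ℕ.* n)
cardinality-× {X} {Y} {m} {n} e e′ = mkInverse
  (λ (x , y) → Fin.combine (E.to x) (E′.to y))
  (λ i → E.from (proj₁ (Fin.remQuot n i)) , E′.from (proj₂ (Fin.remQuot {m} n i)))
  (λ (p , p′) → cong₂ Fin.combine (E.to-cong p) (E′.to-cong p′))
  (λ { refl → Setoid.refl X , Setoid.refl Y })
  (λ i → trans (cong₂ Fin.combine (to∘from e _) (to∘from e′ _)) (Fin.combine-remQuot {m} n i))
  (λ (x , y) → let eq = Fin.remQuot-combine (E.to x) (E′.to y) in
    Setoid.trans X (E.from-cong (cong proj₁ eq)) (from∘to e x) ,
    Setoid.trans Y (E′.from-cong (cong proj₂ eq)) (from∘to e′ y))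
  where
  module E = Inverse e
  module E′ = Inverse e′

cardinality-^ : ∀ {X q} → X HasCardinality q → ∀ n → ≋-setoid X n HasCardinality (q ℕ.^ n)
cardinality-^ {X} e zero    = mkInverse
  (λ _ → zero) (λ _ ()) (λ _ → refl) (λ _ ()) (λ { zero → refl }) (λ _ ())
cardinality-^ {X} {q} e (suc n) =
  Composition.inverse uncons (cardinality-× e (cardinality-^ e n))
  where
  uncons : Inverse (≋-setoid X (suc n)) (×-setoid X (≋-setoid X n))
  uncons = mkInverse
    (λ v → v zero , v ∘ suc)
    (λ { (x , v) zero → x ; (x , v) (suc i) → v i })
    (λ p → p zero , p ∘ suc)
    (λ { (p , p′) zero → p ; (p , p′) (suc i) → p′ i })
    (λ _ → Setoid.refl X , λ _ → Setoid.refl X)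
    (λ { v zero → Setoid.refl X ; v (suc i) → Setoid.refl X })

subsetoid : (X : Setoid 0ℓ 0ℓ) → (Setoid.Carrier X → Set) → Setoid 0ℓ 0ℓ
subsetoid X P = record
  { Carrier       = Σ X.Carrier P
  ; _≈_           = λ x y → proj₁ x X.≈ proj₁ y
  ; isEquivalence = record
    { refl  = λ {x} → X.refl {proj₁ x}
    ; sym   = λ {x} {y} → X.sym {proj₁ x} {proj₁ y}
    ; trans = λ {x} {y} {z} → X.trans {proj₁ x} {proj₁ y} {proj₁ z}
    }
  }
  where module X = Setoid X

indicator : Bool → ℤ
indicator true  = 1ℤ
indicator false = 0ℤ

indicator-∧ : ∀ b c → indicator (b ∧ c) ≡ indicator b ℤ.* indicator c
indicator-∧ true  c = sym (ℤ.*-identityˡ (indicator c))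
indicator-∧ false c = refl

indicator-not : ∀ b → indicator (not b) ≡ 1ℤ ℤ.- indicator b
indicator-not true  = refl
indicator-not false = refl

Fin-subset-cardinality : ∀ n {P : Fin n → Set} (P? : ∀ i → Dec (P i)) →
  ∃[ c ] (subsetoid (setoid (Fin n)) P HasCardinality c × + c ≡ sum (λ i → indicator (does (P? i))))
Fin-subset-cardinality zero    P? =
  0 , mkInverse (λ ()) (λ ()) (λ { {()} }) (λ { {()} }) (λ ()) (λ ()) , refl
Fin-subset-cardinality (suc n) {P} P? with Fin-subset-cardinality n (P? ∘ suc)
... | c , e , eq with P? zero
...   | no ¬p = c , mkInverse to (λ j → suc (proj₁ (E.from j)) , proj₂ (E.from j))
                  (λ {x} {y} → to-cong x y) (λ { refl → refl }) (to∘from e) from∘to′ ,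
                trans eq (sym (ℤ.+-identityˡ _))
  where
  module E = Inverse e
  to : Σ (Fin (suc n)) P → Fin c
  to (zero  , p) = contradiction p ¬p
  to (suc i , p) = E.to (i , p)
  to-cong : ∀ x y → proj₁ x ≡ proj₁ y → to x ≡ to y
  to-cong (zero  , p) _            _    = contradiction p ¬p
  to-cong (suc i , p) (suc .i , p′) refl = E.to-cong refl
  from∘to′ : ∀ x → suc (proj₁ (E.from (to x))) ≡ proj₁ x
  from∘to′ (zero  , p) = contradiction p ¬p
  from∘to′ (suc i , p) = cong suc (from∘to e (i , p))
...   | yes p₀ = suc c , mkInverse to from
                   (λ {x} {y} → to-cong x y) (λ { refl → refl }) to∘from′ from∘to′ ,
                 trans (ℤ.pos-+ 1 c) (cong (λ s → 1ℤ ℤ.+ s) eq)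
  where
  module E = Inverse e
  to : Σ (Fin (suc n)) P → Fin (suc c)
  to (zero  , p) = zero
  to (suc i , p) = suc (E.to (i , p))
  from : Fin (suc c) → Σ (Fin (suc n)) P
  from zero    = zero , p₀
  from (suc j) = suc (proj₁ (E.from j)) , proj₂ (E.from j)
  to-cong : ∀ x y → proj₁ x ≡ proj₁ y → to x ≡ to y
  to-cong (zero  , p) (zero   , p′) refl = refl
  to-cong (suc i , p) (suc .i , p′) refl = cong suc (E.to-cong refl)
  to∘from′ : ∀ j → to (from j) ≡ j
  to∘from′ zero    = refl
  to∘from′ (suc j) = cong suc (to∘from e j)
  from∘to′ : ∀ x → proj₁ (from (to x)) ≡ proj₁ x
  from∘to′ (zero  , p) = refl
  from∘to′ (suc i , p) = cong suc (from∘to e (i , p))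

-- An arbitrary bijection certifies `N`, so its value has to come from elsewhere. Transport along
-- `e` gives a decidable subset of `Fin Q`, whose count is a sum of indicators, and
-- `cardinality-unique` identifies the two.
subset-cardinality : ∀ {X Q N} (e : X HasCardinality Q) {P : Setoid.Carrier X → Set} →
  (∀ {x y} → Setoid._≈_ X x y → P x → P y) → (P? : ∀ x → Dec (P x)) →
  subsetoid X P HasCardinality N →
  + N ≡ sum (λ j → indicator (does (P? (Inverse.from e j))))
subset-cardinality {X} {Q} e {P} P-resp P? e′ =
  let c , e″ , eq = Fin-subset-cardinality Q (λ j → P? (E.from j))
  in trans (cong +_ (cardinality-unique e′ (Composition.inverse transport e″))) eq
  where
  module E = Inverse e
  transport : Inverse (subsetoid X P) (subsetoid (setoid (Fin Q)) (P ∘ E.from))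
  transport = mkInverse
    (λ (x , p) → E.to x , P-resp (Setoid.sym X (from∘to e x)) p)
    (λ (j , p) → E.from j , p)
    E.to-cong E.from-cong (λ (j , _) → to∘from e j) (λ (x , _) → from∘to e x)

-- Inclusion–exclusion

Σᴸ : {A : Set} → (A → ℤ) → List A → ℤ
Σᴸ g = foldr (λ a s → g a ℤ.+ s) 0ℤ

module _ {A : Set} where

  Σᴸ-++ : ∀ (g : A → ℤ) xs ys → Σᴸ g (xs ++ ys) ≡ Σᴸ g xs ℤ.+ Σᴸ g ys
  Σᴸ-++ g []       ys = sym (ℤ.+-identityˡ _)
  Σᴸ-++ g (x ∷ xs) ys = trans (cong (λ s → g x ℤ.+ s) (Σᴸ-++ g xs ys)) (sym (ℤ.+-assoc (g x) _ _))

  Σᴸ-map : ∀ {B : Set} (g : A → ℤ) (h : B → A) xs → Σᴸ g (map h xs) ≡ Σᴸ (g ∘ h) xs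
  Σᴸ-map g h []       = refl
  Σᴸ-map g h (x ∷ xs) = cong (λ s → g (h x) ℤ.+ s) (Σᴸ-map g h xs)

  Σᴸ-cong : ∀ {g h : A → ℤ} → (∀ x → g x ≡ h x) → ∀ xs → Σᴸ g xs ≡ Σᴸ h xs
  Σᴸ-cong g≗h []       = refl
  Σᴸ-cong g≗h (x ∷ xs) = cong₂ ℤ._+_ (g≗h x) (Σᴸ-cong g≗h xs)

  *-distribˡ-Σᴸ : ∀ c (g : A → ℤ) xs → c ℤ.* Σᴸ g xs ≡ Σᴸ (λ x → c ℤ.* g x) xs
  *-distribˡ-Σᴸ c g []       = ℤ.*-zeroʳ c
  *-distribˡ-Σᴸ c g (x ∷ xs) = trans (ℤ.*-distribˡ-+ c (g x) _)
    (cong (λ s → c ℤ.* g x ℤ.+ s) (*-distribˡ-Σᴸ c g xs))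

  sum-Σᴸ-swap : ∀ {n} (g : Fin n → A → ℤ) xs →
    sum (λ j → Σᴸ (g j) xs) ≡ Σᴸ (λ x → sum (λ j → g j x)) xs
  sum-Σᴸ-swap {n} g []       = sum-replicate-zero n
  sum-Σᴸ-swap {n} g (x ∷ xs) = trans (∑-distrib-+ (λ j → g j x) (λ j → Σᴸ (g j) xs))
    (cong (λ s → sum (λ j → g j x) ℤ.+ s) (sum-Σᴸ-swap g xs))

-- Assembled from `map′` and `_×-dec_` so that `does` reduces to a conjunction over head and tail,
-- the shape on which `inclusion-exclusion` recurses. The same holds for `all∈?`.
none? : ∀ {n} {P : Fin n → Set} → (∀ i → Dec (P i)) → Dec (∀ i → ¬ P i)
none? {zero}  P? = yes λ ()
none? {suc n} P? = map′ (λ { (p , ps) zero → p ; (p , ps) (suc i) → ps i })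
  (λ ps → ps zero , ps ∘ suc) (¬? (P? zero) ×-dec none? (P? ∘ suc))

all∈? : ∀ {n} {P : Fin n → Set} → (∀ i → Dec (P i)) →
  (S : Subset n) → Dec (∀ i → i ∈ˢ S → P i)
all∈? P? []            = yes λ ()
all∈? P? (outside ∷ S) = map′ (λ { ps (suc i) (thereⱽ i∈S) → ps i i∈S })
  (λ ps i i∈S → ps (suc i) (thereⱽ i∈S)) (all∈? (P? ∘ suc) S)
all∈? P? (inside ∷ S)  = map′
  (λ { (p , ps) zero _ → p ; (p , ps) (suc i) (thereⱽ i∈S) → ps i i∈S })
  (λ ps → ps zero hereⱽ , λ i i∈S → ps (suc i) (thereⱽ i∈S))
  (P? zero ×-dec all∈? (P? ∘ suc) S)

sign : ∀ {n} → Subset n → ℤ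
sign S = (ℤ.- 1ℤ) ℤ.^ ∣ S ∣

-- Expansion of the product of the factors 1 - bᵢ, where bᵢ indicates `P i`: choosing 1 or -bᵢ in
-- each factor is choosing outside or inside for i.
inclusion-exclusion : ∀ {n} {P : Fin n → Set} (P? : ∀ i → Dec (P i)) →
  indicator (does (none? P?)) ≡
  Σᴸ (λ S → sign S ℤ.* indicator (does (all∈? P? S))) (allSubsets n)
inclusion-exclusion {zero}  P? = refl
inclusion-exclusion {suc n} P? = begin
  indicator (not b ∧ does (none? (P? ∘ suc)))
    ≡⟨ indicator-∧ (not b) _ ⟩
  indicator (not b) ℤ.* indicator (does (none? (P? ∘ suc)))
    ≡⟨ cong₂ ℤ._*_ (indicator-not b) (inclusion-exclusion (P? ∘ suc)) ⟩
  (1ℤ ℤ.- indicator b) ℤ.* Σᴸ term Ss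
    ≡⟨ split (indicator b) (Σᴸ term Ss) ⟩
  Σᴸ term Ss ℤ.+ ℤ.- indicator b ℤ.* Σᴸ term Ss
    ≡⟨ cong₂ ℤ._+_ (sym (Σᴸ-map term′ (outside ∷_) Ss)) with-inside ⟩
  Σᴸ term′ (map (outside ∷_) Ss) ℤ.+ Σᴸ term′ (map (inside ∷_) Ss)
    ≡⟨ Σᴸ-++ term′ (map (outside ∷_) Ss) (map (inside ∷_) Ss) ⟨
  Σᴸ term′ (allSubsets (suc n)) ∎
  where
  open ≡-Reasoning
  b = does (P? zero)
  Ss = allSubsets n
  term : Subset n → ℤ
  term S = sign S ℤ.* indicator (does (all∈? (P? ∘ suc) S))
  term′ : Subset (suc n) → ℤ
  term′ S = sign S ℤ.* indicator (does (all∈? P? S))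
  split : ∀ b s → (1ℤ ℤ.- b) ℤ.* s ≡ s ℤ.+ ℤ.- b ℤ.* s
  split = ℤ-Solver.solve-∀
  regroup : ∀ b s x → ℤ.- b ℤ.* (s ℤ.* x) ≡ (ℤ.- 1ℤ ℤ.* s) ℤ.* (b ℤ.* x)
  regroup = ℤ-Solver.solve-∀
  with-inside : ℤ.- indicator b ℤ.* Σᴸ term Ss ≡ Σᴸ term′ (map (inside ∷_) Ss)
  with-inside = begin
    ℤ.- indicator b ℤ.* Σᴸ term Ss
      ≡⟨ *-distribˡ-Σᴸ (ℤ.- indicator b) term Ss ⟩
    Σᴸ (λ S → ℤ.- indicator b ℤ.* term S) Ss
      ≡⟨ Σᴸ-cong (λ S → trans (regroup (indicator b) (sign S) _)
           (cong (sign (inside ∷ S) ℤ.*_) (sym (indicator-∧ b _)))) Ss ⟩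
    Σᴸ (term′ ∘ (inside ∷_)) Ss
      ≡⟨ Σᴸ-map term′ (inside ∷_) Ss ⟨
    Σᴸ term′ (map (inside ∷_) Ss) ∎

-- Homomorphisms out of ℤⁿ

ℤ-group : Ab
ℤ-group = ℤ.+-0-abelianGroup

module _ (G H : Ab) where
  private
    module G = AbelianGroup G
    module H = AbelianGroup H
  open GroupProperties H.group using (identityˡ-unique; inverseˡ-unique)

  mkHom : (f : G.Carrier → H.Carrier) →
    (∀ {x y} → x G.≈ y → f x H.≈ f y) → (∀ x y → f (x G.∙ y) H.≈ f x H.∙ f y) → Hom G H
  mkHom f f-cong f-homo = record
    { ⟦_⟧ = f
    ; isGroupHomomorphism = record
      { isMonoidHomomorphism = record
        { isMagmaHomomorphism = record
          { isRelHomomorphism = record { cong = f-cong }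
          ; homo = f-homo
          }
        ; ε-homo = f-ε
        }
      ; ⁻¹-homo = λ x → inverseˡ-unique (f (x G.⁻¹)) (f x)
          (H.trans (H.sym (f-homo (x G.⁻¹) x)) (H.trans (f-cong (G.inverseˡ x)) f-ε))
      }
    }
    where
    f-ε : f G.ε H.≈ H.ε
    f-ε = identityˡ-unique (f G.ε) (f G.ε)
      (H.trans (H.sym (f-homo G.ε G.ε)) (f-cong (G.identityˡ G.ε)))

  compose : (K : Ab) → Hom H K → Hom G H → Hom G K
  compose K ψ φ = record
    { ⟦_⟧ = ⟦ ψ ⟧ ∘ ⟦ φ ⟧
    ; isGroupHomomorphism = isGroupHomomorphism (AbelianGroup.trans K)
        (GroupHomomorphism.isGroupHomomorphism φ) (GroupHomomorphism.isGroupHomomorphism ψ)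
    }

Vectorℤ : ℕ → Set
Vectorℤ n = Fin n → ℤ

0ⱽ : ∀ {n} → Vectorℤ n
0ⱽ _ = 0ℤ

basis : ∀ {n} → Fin n → Vectorℤ n
basis zero    = 1ℤ ∷ᶠ 0ⱽ
basis (suc i) = 0ℤ ∷ᶠ basis i

uncons-≗ : ∀ {n} (x : Vectorℤ (suc n)) i → x i ≡ (x zero ∷ᶠ 0ⱽ) i ℤ.+ (0ℤ ∷ᶠ (x ∘ suc)) i
uncons-≗ x zero    = sym (ℤ.+-identityʳ (x zero))
uncons-≗ x (suc i) = sym (ℤ.+-identityˡ (x (suc i)))

module _ (n : ℕ) where

  headInclusion : Hom ℤ-group (ℤ^ suc n)
  headInclusion = mkHom ℤ-group (ℤ^ suc n) (_∷ᶠ 0ⱽ)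
    (λ { eq zero → eq ; eq (suc i) → refl }) (λ { _ _ zero → refl ; _ _ (suc i) → refl })

  tailInclusion : Hom (ℤ^ n) (ℤ^ suc n)
  tailInclusion = mkHom (ℤ^ n) (ℤ^ suc n) (0ℤ ∷ᶠ_)
    (λ { eq zero → refl ; eq (suc i) → eq i }) (λ { _ _ zero → refl ; _ _ (suc i) → refl })

module _ (G : Ab) where
  private module G = AbelianGroup G

  ℤ-ext : (φ ψ : Hom ℤ-group G) → ⟦ φ ⟧ 1ℤ G.≈ ⟦ ψ ⟧ 1ℤ → ∀ z → ⟦ φ ⟧ z G.≈ ⟦ ψ ⟧ z
  ℤ-ext φ ψ eq₁ = ext
    where
    module φ = GroupHomomorphism φ
    module ψ = GroupHomomorphism ψ
    ext⁺ : ∀ n → ⟦ φ ⟧ (+ n) G.≈ ⟦ ψ ⟧ (+ n)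
    ext⁺ zero    = G.trans φ.ε-homo (G.sym ψ.ε-homo)
    ext⁺ (suc n) = G.trans (φ.homo 1ℤ (+ n)) (G.trans (G.∙-cong eq₁ (ext⁺ n)) (G.sym (ψ.homo 1ℤ (+ n))))
    ext : ∀ z → ⟦ φ ⟧ z G.≈ ⟦ ψ ⟧ z
    ext (+ n)    = ext⁺ n
    ext -[1+ n ] = G.trans (φ.⁻¹-homo (+ suc n))
      (G.trans (G.⁻¹-cong (ext⁺ (suc n))) (G.sym (ψ.⁻¹-homo (+ suc n))))

  hom-uncons : ∀ {n} (φ : Hom (ℤ^ suc n) G) x →
    ⟦ φ ⟧ x G.≈ ⟦ φ ⟧ (x zero ∷ᶠ 0ⱽ) G.∙ ⟦ φ ⟧ (0ℤ ∷ᶠ (x ∘ suc))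
  hom-uncons φ x = G.trans (φ.⟦⟧-cong (uncons-≗ x)) (φ.homo (x zero ∷ᶠ 0ⱽ) (0ℤ ∷ᶠ (x ∘ suc)))
    where module φ = GroupHomomorphism φ

  basis-ext : ∀ {n} (φ ψ : Hom (ℤ^ n) G) → (∀ i → ⟦ φ ⟧ (basis i) G.≈ ⟦ ψ ⟧ (basis i)) →
    ∀ x → ⟦ φ ⟧ x G.≈ ⟦ ψ ⟧ x
  basis-ext {zero}  φ ψ eq x = G.trans (φ.⟦⟧-cong λ ())
    (G.trans φ.ε-homo (G.trans (G.sym ψ.ε-homo) (ψ.⟦⟧-cong λ ())))
    where
    module φ = GroupHomomorphism φ
    module ψ = GroupHomomorphism ψ
  basis-ext {suc n} φ ψ eq x = G.trans (hom-uncons φ x) (G.trans (G.∙-cong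
    (ℤ-ext (φ ∘head) (ψ ∘head) (eq zero) (x zero))
    (basis-ext (φ ∘tail) (ψ ∘tail) (eq ∘ suc) (x ∘ suc))) (G.sym (hom-uncons ψ x)))
    where
    _∘head : Hom (ℤ^ suc n) G → Hom ℤ-group G
    φ ∘head = compose ℤ-group (ℤ^ suc n) G φ (headInclusion n)
    _∘tail : Hom (ℤ^ suc n) G → Hom (ℤ^ n) G
    φ ∘tail = compose (ℤ^ n) (ℤ^ suc n) G φ (tailInclusion n)

sum-0 : ∀ {n} {t : Vectorℤ n} → (∀ i → t i ≡ 0ℤ) → sum t ≡ 0ℤ
sum-0 {n} t≗0 = trans (sum-cong-≗ t≗0) (sum-replicate-zero n)

dot : ∀ {n} → Vectorℤ n → Vectorℤ n → ℤ
dot v x = sum (λ i → x i ℤ.* v i)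

dot-0 : ∀ {n} (v : Vectorℤ n) {x} → (∀ i → x i ≡ 0ℤ) → dot v x ≡ 0ℤ
dot-0 v x≗0 = sum-0 (λ i → cong (ℤ._* v i) (x≗0 i))

dot-basis : ∀ {n} (v : Vectorℤ n) i → dot v (basis i) ≡ v i
dot-basis v zero    = trans (cong₂ ℤ._+_ (ℤ.*-identityˡ (v zero)) (dot-0 (v ∘ suc) (λ _ → refl)))
  (ℤ.+-identityʳ (v zero))
dot-basis v (suc i) = trans (ℤ.+-identityˡ _) (dot-basis (v ∘ suc) i)

dotHom : ∀ {n} q → Vectorℤ n → Hom (ℤ^ n) (ℤ/ q)
dotHom {n} q v = mkHom (ℤ^ n) (ℤ/ q) (dot v)
  (λ x≗y → reflexive (sum-cong-≗ (λ i → cong (ℤ._* v i) (x≗y i))))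
  (λ x y → reflexive (trans (sum-cong-≗ (λ i → ℤ.*-distribʳ-+ (v i) (x i) (y i)))
    (∑-distrib-+ (λ i → x i ℤ.* v i) (λ i → y i ℤ.* v i))))
  where open AbelianGroup (ℤ/ q) using (reflexive)

-- Integers modulo q

module _ (q : ℕ) where
  open AbelianGroup (ℤ/ q) using (_≈_; reflexive)
    renaming (sym to ≈-sym; trans to ≈-trans; setoid to ≈-setoid)

  ≈0⇒∣ : ∀ {x} → x ≈ 0ℤ → + q ∣ℤ x
  ≈0⇒∣ {x} = subst (+ q ∣ℤ_) (ℤ.+-identityʳ x)

  ∣⇒≈0 : ∀ {x} → + q ∣ℤ x → x ≈ 0ℤ
  ∣⇒≈0 {x} = subst (+ q ∣ℤ_) (sym (ℤ.+-identityʳ x))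

  -- The difference of the residues is a multiple of q of absolute value below q.
  residue-unique : ∀ {r s} → r ℕ.< q → s ℕ.< q → + r ≈ + s → r ≡ s
  residue-unique {r} {s} r<q s<q r≈s = ℤ.+-injective (ℤ.i-j≡0⇒i≡j (+ r) (+ s)
    (ℤ.∣i∣≡0⇒i≡0 (small ℤ.∣ + r ℤ.- + s ∣ (ℤ∣.∣⇒∣ᵤ r≈s) bound)))
    where
    bound : ℤ.∣ + r ℤ.- + s ∣ ℕ.< q
    bound = ℕ.≤-<-trans (ℕ.≤-reflexive (cong ℤ.∣_∣ (ℤ.m-n≡m⊖n r s)))
      (ℕ.≤-<-trans (ℤ.∣m⊝n∣≤m⊔n r s) (ℕ.⊔-lub r<q s<q))
    small : ∀ d → q ∣ d → d ℕ.< q → d ≡ 0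
    small zero    _   _   = refl
    small (suc d) q∣d d<q = contradiction q∣d (ℕ∣.>⇒∤ d<q)

  _≈?_ : ∀ x y → Dec (x ≈ y)
  x ≈? y = map′ ℤ∣.∣ᵤ⇒∣ ℤ∣.∣⇒∣ᵤ (q ℕ∣.∣? ℤ.∣ x ℤ.- y ∣)

  ℤ/-cardinality : NonZero q → ≈-setoid HasCardinality q
  ℤ/-cardinality q≢0 = mkInverse
    (λ x → Fin.fromℕ< (ℤ.n%ℕd<d x q))
    (λ i → + Fin.toℕ i)
    (λ {x} {y} x≈y → Fin.fromℕ<-cong _ _
      (residue-unique (ℤ.n%ℕd<d x q) (ℤ.n%ℕd<d y q)
        (≈-trans {+ (x ℤ.%ℕ q)} {x} {+ (y ℤ.%ℕ q)} (residue x)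
          (≈-trans {x} {y} {+ (y ℤ.%ℕ q)} x≈y (≈-sym {+ (y ℤ.%ℕ q)} {y} (residue y))))) _ _)
    (λ { {i} refl → reflexive {+ Fin.toℕ i} refl })
    (λ i → trans (Fin.fromℕ<-cong _ _
      (residue-unique (ℤ.n%ℕd<d (+ Fin.toℕ i) q) (Fin.toℕ<n i) (residue (+ Fin.toℕ i))) _ (Fin.toℕ<n i))
      (Fin.fromℕ<-toℕ i (Fin.toℕ<n i)))
    (λ x → subst (λ r → + r ≈ x) (sym (Fin.toℕ-fromℕ< (ℤ.n%ℕd<d x q))) (residue x))
    where
    instance _ = q≢0
    residue : ∀ x → + (x ℤ.%ℕ q) ≈ x
    residue x = ≈-sym {x} (ℤ∣.divides (x ℤ./ℕ q)
      (trans (cong (ℤ._- + (x ℤ.%ℕ q)) (ℤ.a≡a%ℕn+[a/ℕn]*n x q)) (cancel (+ (x ℤ.%ℕ q)) _)))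
      where
      cancel : ∀ r m → (r ℤ.+ m) ℤ.- r ≡ m
      cancel = ℤ-Solver.solve-∀

  Hom-ℤⁿ : ∀ n → Inverse (HomSetoid (ℤ^ n) (ℤ/ q)) (≋-setoid ≈-setoid n)
  Hom-ℤⁿ n = mkInverse
    (λ φ i → ⟦ φ ⟧ (basis i))
    (dotHom q)
    (λ φ≈ψ i → φ≈ψ (basis i))
    (λ {v} {w} v≈w → basis-ext (ℤ/ q) (dotHom q v) (dotHom q w)
      (λ i → ≈-trans {dot v (basis i)} {v i} (reflexive (dot-basis v i))
        (≈-trans {v i} {w i} (v≈w i) (reflexive (sym (dot-basis w i))))))
    (λ v i → reflexive (dot-basis v i))
    (λ φ → basis-ext (ℤ/ q) (dotHom q _) φ (λ i → reflexive (dot-basis _ i)))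

  Hom-ℤⁿ-cardinality : NonZero q → ∀ n → HomSetoid (ℤ^ n) (ℤ/ q) HasCardinality (q ℕ.^ n)
  Hom-ℤⁿ-cardinality q≢0 n =
    Composition.inverse (Hom-ℤⁿ n) (cardinality-^ (ℤ/-cardinality q≢0) n)

infixr 7 _⊙_
_⊙_ : ∀ {n} → ℤ → Vectorℤ n → Vectorℤ n
(c ⊙ x) i = c ℤ.* x i

scalars : ∀ {n} → Vectorℤ n → Hom ℤ-group (ℤ^ n)
scalars {n} x = mkHom ℤ-group (ℤ^ n) (_⊙ x)
  (λ { refl i → refl }) (λ c d i → ℤ.*-distribʳ-+ (x i) c d)

1⊙ : ∀ {n} (x : Vectorℤ n) i → (1ℤ ⊙ x) i ≡ x i
1⊙ x i = ℤ.*-identityˡ (x i)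

-- A homomorphism out of ℤ is determined at 1. Applied to c ↦ φ (c ⊙ x), this makes additive maps
-- ℤ-linear, once `μ` spells out the expected value as a homomorphism in c.
scalars-ext : ∀ (G : Ab) {n} (φ : Hom (ℤ^ n) G) x (μ : Hom ℤ-group G) →
  AbelianGroup._≈_ G (⟦ φ ⟧ x) (⟦ μ ⟧ 1ℤ) → ∀ c → AbelianGroup._≈_ G (⟦ φ ⟧ (c ⊙ x)) (⟦ μ ⟧ c)
scalars-ext G {n} φ x μ eq = ℤ-ext G (compose ℤ-group (ℤ^ n) G φ (scalars x)) μ
  (AbelianGroup.trans G (GroupHomomorphism.⟦⟧-cong φ (1⊙ x)) eq)

⟦⟧-⊙ : ∀ {m n} (φ : Hom (ℤ^ m) (ℤ^ n)) c x i → ⟦ φ ⟧ (c ⊙ x) i ≡ c ℤ.* ⟦ φ ⟧ x i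
⟦⟧-⊙ {m} {n} φ c x = scalars-ext (ℤ^ n) φ x (scalars (⟦ φ ⟧ x)) (λ i → sym (1⊙ (⟦ φ ⟧ x) i)) c

multiples : ℤ → Hom ℤ-group ℤ-group
multiples a = mkHom ℤ-group ℤ-group (ℤ._* a) (cong (ℤ._* a)) (λ c d → ℤ.*-distribʳ-+ a c d)

⟦⟧-⊙-ℤ : ∀ {n} (φ : Hom (ℤ^ n) ℤ-group) c x → ⟦ φ ⟧ (c ⊙ x) ≡ c ℤ.* ⟦ φ ⟧ x
⟦⟧-⊙-ℤ φ c x = scalars-ext ℤ-group φ x (multiples (⟦ φ ⟧ x)) (sym (ℤ.*-identityˡ (⟦ φ ⟧ x))) c

-- Unimodular transformations

record Automorphism (n : ℕ) : Set where
  field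
    forth back : Hom (ℤ^ n) (ℤ^ n)
    forth∘back : ∀ x i → ⟦ forth ⟧ (⟦ back ⟧ x) i ≡ x i
    back∘forth : ∀ x i → ⟦ back ⟧ (⟦ forth ⟧ x) i ≡ x i

open Automorphism

identityᴬ : ∀ n → Automorphism n
identityᴬ n = record
  { forth = idHom ; back = idHom ; forth∘back = λ _ _ → refl ; back∘forth = λ _ _ → refl }
  where
  idHom : Hom (ℤ^ n) (ℤ^ n)
  idHom = mkHom (ℤ^ n) (ℤ^ n) id id (λ _ _ _ → refl)

_∘ᴬ_ : ∀ {n} → Automorphism n → Automorphism n → Automorphism n
_∘ᴬ_ {n} V W = record
  { forth = compose (ℤ^ n) (ℤ^ n) (ℤ^ n) (forth V) (forth W)
  ; back  = compose (ℤ^ n) (ℤ^ n) (ℤ^ n) (back W) (back V)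
  ; forth∘back = λ x i → trans
      (GroupHomomorphism.⟦⟧-cong (forth V) (forth∘back W (⟦ back V ⟧ x)) i) (forth∘back V x i)
  ; back∘forth = λ x i → trans
      (GroupHomomorphism.⟦⟧-cong (back W) (back∘forth V (⟦ forth W ⟧ x)) i) (back∘forth W x i)
  }

liftᴬ : ∀ {n} → Automorphism n → Automorphism (suc n)
liftᴬ {n} V = record
  { forth = liftHom (forth V)
  ; back  = liftHom (back V)
  ; forth∘back = λ { x zero → refl ; x (suc i) → forth∘back V (x ∘ suc) i }
  ; back∘forth = λ { x zero → refl ; x (suc i) → back∘forth V (x ∘ suc) i }
  }
  where
  liftHom : Hom (ℤ^ n) (ℤ^ n) → Hom (ℤ^ suc n) (ℤ^ suc n)
  liftHom φ = mkHom (ℤ^ suc n) (ℤ^ suc n) (λ x → x zero ∷ᶠ ⟦ φ ⟧ (x ∘ suc))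
    (λ { eq zero → eq zero ; eq (suc i) → φ.⟦⟧-cong (eq ∘ suc) i })
    (λ { x y zero → refl ; x y (suc i) → φ.homo (x ∘ suc) (y ∘ suc) i })
    where module φ = GroupHomomorphism φ

-- One division step of Euclid's algorithm: on the first two coordinates, the matrix with rows (0,
-- 1) and (1, -c). Its determinant is -1, so it is invertible over ℤ for every c.
euclideanStep : ∀ n → ℤ → Automorphism (suc (suc n))
euclideanStep n c = record
  { forth = mkHom (ℤ^ suc (suc n)) (ℤ^ suc (suc n)) forth′
      (λ { eq zero          → eq (suc zero)
         ; eq (suc zero)    → cong₂ (λ a b → a ℤ.- c ℤ.* b) (eq zero) (eq (suc zero))
         ; eq (suc (suc i)) → eq (suc (suc i)) })
      (λ { x y zero          → refl
         ; x y (suc zero)    → linear₁ c (x zero) (x (suc zero)) (y zero) (y (suc zero))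
         ; x y (suc (suc i)) → refl })
  ; back = mkHom (ℤ^ suc (suc n)) (ℤ^ suc (suc n)) back′
      (λ { eq zero          → cong₂ (λ a b → b ℤ.+ c ℤ.* a) (eq zero) (eq (suc zero))
         ; eq (suc zero)    → eq zero
         ; eq (suc (suc i)) → eq (suc (suc i)) })
      (λ { x y zero          → linear₂ c (x zero) (x (suc zero)) (y zero) (y (suc zero))
         ; x y (suc zero)    → refl
         ; x y (suc (suc i)) → refl })
  ; forth∘back = λ { x zero          → refl
                   ; x (suc zero)    → cancel₁ (x (suc zero)) (c ℤ.* x zero)
                   ; x (suc (suc i)) → refl }
  ; back∘forth = λ { x zero          → cancel₂ (x zero) (c ℤ.* x (suc zero))
                   ; x (suc zero)    → refl
                   ; x (suc (suc i)) → refl }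
  }
  where
  forth′ back′ : Vectorℤ (suc (suc n)) → Vectorℤ (suc (suc n))
  forth′ x = x (suc zero) ∷ᶠ (x zero ℤ.- c ℤ.* x (suc zero)) ∷ᶠ (λ i → x (suc (suc i)))
  back′  x = (x (suc zero) ℤ.+ c ℤ.* x zero) ∷ᶠ x zero ∷ᶠ (λ i → x (suc (suc i)))
  linear₁ : ∀ c x₀ x₁ y₀ y₁ → (x₀ ℤ.+ y₀) ℤ.- c ℤ.* (x₁ ℤ.+ y₁) ≡ (x₀ ℤ.- c ℤ.* x₁) ℤ.+ (y₀ ℤ.- c ℤ.* y₁)
  linear₁ = ℤ-Solver.solve-∀
  linear₂ : ∀ c x₀ x₁ y₀ y₁ → (x₁ ℤ.+ y₁) ℤ.+ c ℤ.* (x₀ ℤ.+ y₀) ≡ (x₁ ℤ.+ c ℤ.* x₀) ℤ.+ (y₁ ℤ.+ c ℤ.* y₀)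
  linear₂ = ℤ-Solver.solve-∀
  cancel₁ : ∀ a b → (a ℤ.+ b) ℤ.- b ≡ a
  cancel₁ = ℤ-Solver.solve-∀
  cancel₂ : ∀ a b → (a ℤ.- b) ℤ.+ b ≡ a
  cancel₂ = ℤ-Solver.solve-∀

-- Euclid's algorithm on the first two entries: the absolute value of the second decreases to 0. The
-- clause on the remaining coordinates lets `clearTail` keep the zeros already made.
clearSecond : ∀ {n} (a : Vectorℤ (suc (suc n))) → Acc ℕ._<_ ℤ.∣ a (suc zero) ∣ →
  Σ[ V ∈ Automorphism (suc (suc n)) ] (⟦ forth V ⟧ a (suc zero) ≡ 0ℤ ×
    (∀ x i → ⟦ forth V ⟧ x (suc (suc i)) ≡ x (suc (suc i))))
clearSecond {n} a (acc rec) with a (suc zero) ℤ.≟ 0ℤ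
... | yes a₁≡0 = identityᴬ _ , a₁≡0 , λ _ _ → refl
... | no  a₁≢0 =
  let V , cleared , fixed = clearSecond (⟦ forth E ⟧ a) (rec decreasing)
  in V ∘ᴬ E , cleared , λ x i → fixed (⟦ forth E ⟧ x) i
  where
  instance _ = ℤ.≢-nonZero a₁≢0
  c = a zero ℤ./ a (suc zero)
  E = euclideanStep n c
  cancel : ∀ r m → (r ℤ.+ m) ℤ.- m ≡ r
  cancel = ℤ-Solver.solve-∀
  remainder : a zero ℤ.- c ℤ.* a (suc zero) ≡ + (a zero ℤ.% a (suc zero))
  remainder = trans (cong (ℤ._- c ℤ.* a (suc zero)) (ℤ.a≡a%n+[a/n]*n (a zero) (a (suc zero)))) (cancel _ (c ℤ.* a (suc zero)))
  decreasing : ℤ.∣ a zero ℤ.- c ℤ.* a (suc zero) ∣ ℕ.< ℤ.∣ a (suc zero) ∣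
  decreasing = ℕ.≤-<-trans (ℕ.≤-reflexive (cong ℤ.∣_∣ remainder)) (ℤ.n%d<d (a zero) (a (suc zero)))

-- Recursion on the tail brings a to the form (a₀, g, 0, ..., 0); `clearSecond` then merges g into
-- the head without touching the zeros.
clearTail : ∀ {n} (a : Vectorℤ (suc n)) →
  Σ[ V ∈ Automorphism (suc n) ] (∀ i → ⟦ forth V ⟧ a (suc i) ≡ 0ℤ)
clearTail {zero}  a = identityᴬ _ , λ ()
clearTail {suc n} a =
  let W , W-cleared = clearTail (a ∘ suc)
      V , cleared , fixed = clearSecond (⟦ forth (liftᴬ W) ⟧ a) (<-wellFounded _)
  in V ∘ᴬ liftᴬ W ,
     λ { zero → cleared ; (suc i) → trans (fixed (⟦ forth (liftᴬ W) ⟧ a) i) (W-cleared i) }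

-- Splitting off the saturation of a subgroup

module _ {n : ℕ} {P : Pred (Vectorℤ n) 0ℓ} where

  Generated-⊙ : ∀ c {x} → Generated (ℤ^ n) P x → Generated (ℤ^ n) P (c ⊙ x)
  Generated-⊙ c {x} g = go c
    where
    go⁺ : ∀ m → Generated (ℤ^ n) P ((+ m) ⊙ x)
    go⁺ zero    = resp (λ i → refl) ε∈
    go⁺ (suc m) = resp (λ i → sym (ℤ.suc-* (+ m) (x i))) (∙∈ g (go⁺ m))
    go : ∀ c → Generated (ℤ^ n) P (c ⊙ x)
    go (+ m)    = go⁺ m
    go -[1+ m ] = resp (λ i → ℤ.neg-distribˡ-* (+ suc m) (x i)) (⁻¹∈ (go⁺ (suc m)))

  Generated-⊆ : ∀ {Q} → (∀ {x} → P x → Q x) → ∀ {x} → Generated (ℤ^ n) P x → Generated (ℤ^ n) Q x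
  Generated-⊆ P⊆Q (gen p)    = gen (P⊆Q p)
  Generated-⊆ P⊆Q ε∈         = ε∈
  Generated-⊆ P⊆Q (∙∈ g h)   = ∙∈ (Generated-⊆ P⊆Q g) (Generated-⊆ P⊆Q h)
  Generated-⊆ P⊆Q (⁻¹∈ g)    = ⁻¹∈ (Generated-⊆ P⊆Q g)
  Generated-⊆ P⊆Q (resp e g) = resp e (Generated-⊆ P⊆Q g)

  module _ (G : Ab) (φ : Hom (ℤ^ n) G) where
    private
      module G = AbelianGroup G
      module φ = GroupHomomorphism φ

    Generated-kernel : (∀ {x} → P x → ⟦ φ ⟧ x G.≈ G.ε) → ∀ {x} → Generated (ℤ^ n) P x → ⟦ φ ⟧ x G.≈ G.ε
    Generated-kernel kills (gen p)    = kills p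
    Generated-kernel kills ε∈         = φ.ε-homo
    Generated-kernel kills (∙∈ {x} {y} g h) = G.trans (φ.homo x y)
      (G.trans (G.∙-cong (Generated-kernel kills g) (Generated-kernel kills h)) (G.identityˡ G.ε))
    Generated-kernel kills (⁻¹∈ {x} g) = G.trans (φ.⁻¹-homo x)
      (G.trans (G.⁻¹-cong (Generated-kernel kills g)) (GroupProperties.ε⁻¹≈ε G.group))
    Generated-kernel kills (resp e g) = G.trans (φ.⟦⟧-cong (λ i → sym (e i))) (Generated-kernel kills g)

-- ker π is the saturation {x | c x ∈ ⟨P⟩ for some c ≠ 0}, and σ exhibits it as a direct summand.
record Splitting {n} (P : Pred (Vectorℤ n) 0ℓ) : Set where
  field
    corank : ℕ
    π      : Hom (ℤ^ n) (ℤ^ corank)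
    σ      : Hom (ℤ^ corank) (ℤ^ n)
    π∘σ    : ∀ y i → ⟦ π ⟧ (⟦ σ ⟧ y) i ≡ y i
    π-P    : ∀ {x} → P x → ∀ i → ⟦ π ⟧ x i ≡ 0ℤ
    ker-π  : ∀ {x} → (∀ i → ⟦ π ⟧ x i ≡ 0ℤ) → ∃[ c ] (c ≢ 0ℤ × Generated (ℤ^ n) P (c ⊙ x))

Splitting-∅ : ∀ {n} {P : Pred (Vectorℤ n) 0ℓ} → (∀ {x} → ¬ P x) → Splitting P
Splitting-∅ {n} ¬P = record
  { corank = n
  ; π      = forth (identityᴬ n)
  ; σ      = forth (identityᴬ n)
  ; π∘σ    = λ _ _ → refl
  ; π-P    = λ p → contradiction p ¬P
  ; ker-π  = λ x≗0 → 1ℤ , (λ ()) , resp (λ i → sym (trans (ℤ.*-identityˡ _) (x≗0 i))) ε∈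
  }

Splitting-resp : ∀ {n} {P Q : Pred (Vectorℤ n) 0ℓ} →
  (∀ {x} → P x → Q x) → (∀ {x} → Q x → P x) → Splitting P → Splitting Q
Splitting-resp P⊆Q Q⊆P s = record
  { corank = corank ; π = π ; σ = σ ; π∘σ = π∘σ
  ; π-P    = π-P ∘ Q⊆P
  ; ker-π  = λ πx≗0 → let c , c≢0 , g = ker-π πx≗0 in c , c≢0 , Generated-⊆ P⊆Q g
  }
  where open Splitting s

module _ {n} {P : Pred (Vectorℤ n) 0ℓ} (a : Vectorℤ n) where

  -- A vector killed by π already lies in the saturation, so adjoining it changes neither the
  -- saturation nor its complement.
  Splitting-adjoin-kernel : (s : Splitting P) → (∀ i → ⟦ Splitting.π s ⟧ a i ≡ 0ℤ) →
    Splitting (λ x → x ≡ a ⊎ P x)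
  Splitting-adjoin-kernel s πa≗0 = record
    { corank = corank ; π = π ; σ = σ ; π∘σ = π∘σ
    ; π-P    = λ { (inj₁ refl) → πa≗0 ; (inj₂ p) → π-P p }
    ; ker-π  = λ πx≗0 → let c , c≢0 , g = ker-π πx≗0 in c , c≢0 , Generated-⊆ inj₂ g
    }
    where open Splitting s

  -- After a change of basis of ℤ^corank, π a = (g, 0, ..., 0). If g = 0, a already lies in the
  -- saturation. If g ≠ 0, the whole first axis becomes saturated, whatever g is, so the new π drops
  -- the first coordinate.
  Splitting-adjoin : Splitting P → Splitting (λ x → x ≡ a ⊎ P x)
  Splitting-adjoin s@record { corank = zero } = Splitting-adjoin-kernel s λ ()
  Splitting-adjoin s@record { corank = suc f ; π = π ; σ = σ ; π∘σ = π∘σ ; π-P = π-P ; ker-π = ker-π }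
    with clearTail (⟦ π ⟧ a)
  ... | V , cleared with ⟦ forth V ⟧ (⟦ π ⟧ a) zero in g-eq
  ... | g with g ℤ.≟ 0ℤ
  ... | yes g≡0 = Splitting-adjoin-kernel s (λ i → trans (sym (back∘forth V _ i))
    (trans (back.⟦⟧-cong {y = 0ⱽ} (λ { zero → trans g-eq g≡0 ; (suc j) → cleared j }) i) (back.ε-homo i)))
    where module back = GroupHomomorphism (back V)
  ... | no  g≢0 = record
    { corank = f
    ; π      = mkHom (ℤ^ n) (ℤ^ f) (λ x → ⟦ Vπ ⟧ x ∘ suc)
        (λ eq → Vπ.⟦⟧-cong eq ∘ suc) (λ x y → Vπ.homo x y ∘ suc)
    ; σ      = compose (ℤ^ f) (ℤ^ suc f) (ℤ^ n) σ
        (compose (ℤ^ f) (ℤ^ suc f) (ℤ^ suc f) (back V) (tailInclusion f))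
    ; π∘σ    = λ y i → trans (forth.⟦⟧-cong (π∘σ _) (suc i)) (forth∘back V (0ℤ ∷ᶠ y) (suc i))
    ; π-P    = λ { (inj₁ refl) → cleared
                 ; (inj₂ p) → λ i → trans (forth.⟦⟧-cong (π-P p) (suc i)) (forth.ε-homo (suc i)) }
    -- If π x is (h, 0, ..., 0) in the new basis, then g x - h a is killed by π, so some c (g x - h
    -- a) lies in ⟨P⟩. Adding (c h) a puts (c g) x in the group generated by a and P.
    ; ker-π  = λ {x} Vπx≗0 → let c , c≢0 , generated = ker-π (relation-kernel x Vπx≗0) in
        c ℤ.* g , nonzero c≢0 ,
        resp (λ i → combine c g (⟦ Vπ ⟧ x zero) (x i) (a i))
          (∙∈ (Generated-⊆ inj₂ generated)
              (Generated-⊙ (c ℤ.* ⟦ Vπ ⟧ x zero) (gen (inj₁ refl))))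
    }
    where
    module forth = GroupHomomorphism (forth V)
    module back = GroupHomomorphism (back V)
    Vπ : Hom (ℤ^ n) (ℤ^ suc f)
    Vπ = compose (ℤ^ n) (ℤ^ suc f) (ℤ^ suc f) (forth V) π
    module Vπ = GroupHomomorphism Vπ
    nonzero : ∀ {c} → c ≢ 0ℤ → c ℤ.* g ≢ 0ℤ
    nonzero {c} c≢0 cg≡0 with ℤ.i*j≡0⇒i≡0∨j≡0 c cg≡0
    ... | inj₁ c≡0 = c≢0 c≡0
    ... | inj₂ g≡0 = g≢0 g≡0
    combine : ∀ c g h x a →
      c ℤ.* (g ℤ.* x ℤ.- h ℤ.* a) ℤ.+ (c ℤ.* h) ℤ.* a ≡ (c ℤ.* g) ℤ.* x
    combine = ℤ-Solver.solve-∀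
    relation : Vectorℤ n → Vectorℤ n
    relation x i = g ℤ.* x i ℤ.- ⟦ Vπ ⟧ x zero ℤ.* a i
    Vπ-relation : ∀ x i → ⟦ Vπ ⟧ (relation x) i ≡ g ℤ.* ⟦ Vπ ⟧ x i ℤ.- ⟦ Vπ ⟧ x zero ℤ.* ⟦ Vπ ⟧ a i
    Vπ-relation x i = trans (Vπ.homo (g ⊙ x) _ i) (cong₂ ℤ._+_ (⟦⟧-⊙ Vπ g x i)
      (trans (Vπ.⁻¹-homo (⟦ Vπ ⟧ x zero ⊙ a) i) (cong ℤ.-_ (⟦⟧-⊙ Vπ (⟦ Vπ ⟧ x zero) a i))))
    commute : ∀ g h → g ℤ.* h ℤ.- h ℤ.* g ≡ 0ℤ
    commute = ℤ-Solver.solve-∀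
    zeros : ∀ g h → g ℤ.* 0ℤ ℤ.- h ℤ.* 0ℤ ≡ 0ℤ
    zeros = ℤ-Solver.solve-∀
    relation-kernel : ∀ x → (∀ i → ⟦ Vπ ⟧ x (suc i) ≡ 0ℤ) → ∀ i → ⟦ π ⟧ (relation x) i ≡ 0ℤ
    relation-kernel x Vπx≗0 i = trans (sym (back∘forth V _ i))
      (trans (back.⟦⟧-cong {y = 0ⱽ} vanish i) (back.ε-homo i))
      where
      vanish : ∀ j → ⟦ Vπ ⟧ (relation x) j ≡ 0ℤ
      vanish zero    = trans (Vπ-relation x zero)
        (trans (cong (λ y → g ℤ.* ⟦ Vπ ⟧ x zero ℤ.- ⟦ Vπ ⟧ x zero ℤ.* y) g-eq) (commute g (⟦ Vπ ⟧ x zero)))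
      vanish (suc j) = trans (Vπ-relation x (suc j))
        (trans (cong₂ (λ y z → g ℤ.* y ℤ.- ⟦ Vπ ⟧ x zero ℤ.* z) (Vπx≗0 j) (cleared j)) (zeros g (⟦ Vπ ⟧ x zero)))

splitting : ∀ {n} (A : List (Vectorℤ n)) (S : Sublist A) → Splitting (Members A S)
splitting []      []            = Splitting-∅ λ ()
splitting (a ∷ A) (outside ∷ S) = Splitting-resp
  (λ { (i , i∈S , eq) → suc i , thereⱽ i∈S , eq })
  (λ { (suc i , thereⱽ i∈S , eq) → i , i∈S , eq })
  (splitting A S)
splitting (a ∷ A) (inside ∷ S)  = Splitting-resp
  (λ { (inj₁ eq) → zero , hereⱽ , eq ; (inj₂ (i , i∈S , eq)) → suc i , thereⱽ i∈S , eq })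
  (λ { (zero , _ , eq) → inj₁ eq ; (suc i , thereⱽ i∈S , eq) → inj₂ (i , i∈S , eq) })
  (Splitting-adjoin a (splitting A S))

-- Rank

TrivialKernel : ∀ {m n} → Hom (ℤ^ m) (ℤ^ n) → Set
TrivialKernel φ = ∀ x → (∀ i → ⟦ φ ⟧ x i ≡ 0ℤ) → ∀ i → x i ≡ 0ℤ

-- For counting ranks, a copy of ℤⁿ inside the kernel is enough; it may be a proper subgroup. If c =
-- h(e₀) is nonzero, y ↦ (-h(0, y), c y) works, since the contributions -h(0, y) c and c h(0, y)
-- cancel. If c = 0, e₀ is kept and the other coordinates are treated by recursion.
kernelInclusion : ∀ n (h : Hom (ℤ^ suc n) ℤ-group) →
  Σ[ ι ∈ Hom (ℤ^ n) (ℤ^ suc n) ] ((∀ y → ⟦ h ⟧ (⟦ ι ⟧ y) ≡ 0ℤ) × TrivialKernel ι)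
kernelInclusion n h with ⟦ h ⟧ (1ℤ ∷ᶠ 0ⱽ) in h-basis
... | c with c ℤ.≟ 0ℤ
... | no  c≢0 = ι , h∘ι≗0 , λ y ιy≗0 i → nonzero-multiple (y i) (ιy≗0 (suc i))
  where
  module h = GroupHomomorphism h
  h∘tail : Hom (ℤ^ n) ℤ-group
  h∘tail = compose (ℤ^ n) (ℤ^ suc n) ℤ-group h (tailInclusion n)
  module h∘tail = GroupHomomorphism h∘tail
  ι : Hom (ℤ^ n) (ℤ^ suc n)
  ι = mkHom (ℤ^ n) (ℤ^ suc n) (λ y → (ℤ.- ⟦ h∘tail ⟧ y) ∷ᶠ (c ⊙ y))
    (λ { eq zero → cong ℤ.-_ (h∘tail.⟦⟧-cong eq) ; eq (suc i) → cong (c ℤ.*_) (eq i) })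
    (λ { x y zero → trans (cong ℤ.-_ (h∘tail.homo x y)) (ℤ.neg-distrib-+ (⟦ h∘tail ⟧ x) (⟦ h∘tail ⟧ y))
       ; x y (suc i) → ℤ.*-distribˡ-+ c (x i) (y i) })
  h-head : ∀ z → ⟦ h ⟧ (z ∷ᶠ 0ⱽ) ≡ z ℤ.* c
  h-head = ℤ-ext ℤ-group (compose ℤ-group (ℤ^ suc n) ℤ-group h (headInclusion n)) (multiples c)
    (trans h-basis (sym (ℤ.*-identityˡ c)))
  cancel : ∀ t c → (ℤ.- t) ℤ.* c ℤ.+ c ℤ.* t ≡ 0ℤ
  cancel = ℤ-Solver.solve-∀
  h∘ι≗0 : ∀ y → ⟦ h ⟧ (⟦ ι ⟧ y) ≡ 0ℤ
  h∘ι≗0 y = begin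
    ⟦ h ⟧ (⟦ ι ⟧ y)                                              ≡⟨ hom-uncons ℤ-group h (⟦ ι ⟧ y) ⟩
    ⟦ h ⟧ ((ℤ.- ⟦ h∘tail ⟧ y) ∷ᶠ 0ⱽ) ℤ.+ ⟦ h∘tail ⟧ (c ⊙ y)      ≡⟨ cong₂ ℤ._+_ (h-head _) (⟦⟧-⊙-ℤ h∘tail c y) ⟩
    (ℤ.- ⟦ h∘tail ⟧ y) ℤ.* c ℤ.+ c ℤ.* ⟦ h∘tail ⟧ y              ≡⟨ cancel (⟦ h∘tail ⟧ y) c ⟩
    0ℤ                                                           ∎
    where open ≡-Reasoning
  nonzero-multiple : ∀ z → c ℤ.* z ≡ 0ℤ → z ≡ 0ℤ
  nonzero-multiple z cz≡0 with ℤ.i*j≡0⇒i≡0∨j≡0 c cz≡0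
  ... | inj₁ c≡0 = contradiction c≡0 c≢0
  ... | inj₂ z≡0 = z≡0
kernelInclusion zero    h | c | yes c≡0 =
  mkHom (ℤ^ 0) (ℤ^ 1) (λ _ → 0ⱽ) (λ _ _ → refl) (λ _ _ _ → refl) , (λ _ → h.ε-homo) , λ _ _ ()
  where module h = GroupHomomorphism h
kernelInclusion (suc n) h | c | yes c≡0
  with kernelInclusion n (compose (ℤ^ suc n) (ℤ^ suc (suc n)) ℤ-group h (tailInclusion (suc n)))
... | ι′ , h∘ι′≗0 , ι′-kernel = ι , h∘ι≗0 ,
    λ { y ιy≗0 zero → ιy≗0 zero ; y ιy≗0 (suc i) → ι′-kernel (y ∘ suc) (ιy≗0 ∘ suc) i }
  where
  module ι′ = GroupHomomorphism ι′
  ι : Hom (ℤ^ suc n) (ℤ^ suc (suc n))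
  ι = mkHom (ℤ^ suc n) (ℤ^ suc (suc n)) (λ y → y zero ∷ᶠ ⟦ ι′ ⟧ (y ∘ suc))
    (λ { eq zero → eq zero ; eq (suc i) → ι′.⟦⟧-cong (eq ∘ suc) i })
    (λ { x y zero → refl ; x y (suc i) → ι′.homo (x ∘ suc) (y ∘ suc) i })
  h-head : ∀ z → ⟦ h ⟧ (z ∷ᶠ 0ⱽ) ≡ z ℤ.* 0ℤ
  h-head = ℤ-ext ℤ-group (compose ℤ-group (ℤ^ suc (suc n)) ℤ-group h (headInclusion (suc n))) (multiples 0ℤ)
    (trans h-basis c≡0)
  h∘ι≗0 : ∀ y → ⟦ h ⟧ (⟦ ι ⟧ y) ≡ 0ℤ
  h∘ι≗0 y = trans (hom-uncons ℤ-group h (⟦ ι ⟧ y))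
    (cong₂ ℤ._+_ (trans (h-head (y zero)) (ℤ.*-zeroʳ (y zero))) (h∘ι′≗0 (y ∘ suc)))

-- The first coordinate of φ is a functional, whose kernel contains a free group of rank one less
-- than the source. There the remaining coordinates still have trivial kernel, so both dimensions
-- drop by one. When no coordinate is left, `basis zero` would be in the kernel.
trivialKernel⇒≤ : ∀ m n (φ : Hom (ℤ^ m) (ℤ^ n)) → TrivialKernel φ → m ℕ.≤ n
trivialKernel⇒≤ zero    n       φ kernel = ℕ.z≤n
trivialKernel⇒≤ (suc m) zero    φ kernel = contradiction (kernel (basis zero) (λ ()) zero) λ ()
trivialKernel⇒≤ (suc m) (suc n) φ kernel =
  ℕ.s≤s (trivialKernel⇒≤ m n (compose (ℤ^ m) (ℤ^ suc m) (ℤ^ n) tailφ ι)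
    (λ y eq → ι-kernel y (kernel (⟦ ι ⟧ y) (λ { zero → headφ∘ι≗0 y ; (suc i) → eq i }))))
  where
  module φ = GroupHomomorphism φ
  headφ : Hom (ℤ^ suc m) ℤ-group
  headφ = mkHom (ℤ^ suc m) ℤ-group (λ x → ⟦ φ ⟧ x zero) (λ eq → φ.⟦⟧-cong eq zero) (λ x y → φ.homo x y zero)
  tailφ : Hom (ℤ^ suc m) (ℤ^ n)
  tailφ = mkHom (ℤ^ suc m) (ℤ^ n) (λ x → ⟦ φ ⟧ x ∘ suc) (λ eq → φ.⟦⟧-cong eq ∘ suc) (λ x y → φ.homo x y ∘ suc)
  ι = proj₁ (kernelInclusion m headφ)
  headφ∘ι≗0 = proj₁ (proj₂ (kernelInclusion m headφ))
  ι-kernel = proj₂ (proj₂ (kernelInclusion m headφ))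

module _ {n} {P : Pred (Vectorℤ n) 0ℓ} (s : Splitting P) where
  open Splitting s
  private
    module π = GroupHomomorphism π
    module σ = GroupHomomorphism σ

  -- The projection id - σπ of ℤⁿ onto ker π along the image of σ.
  τ : Vectorℤ n → Vectorℤ n
  τ x i = x i ℤ.- ⟦ σ ⟧ (⟦ π ⟧ x) i

  τ-cong : ∀ {x y} → (∀ i → x i ≡ y i) → ∀ i → τ x i ≡ τ y i
  τ-cong eq i = cong₂ ℤ._-_ (eq i) (σ.⟦⟧-cong (π.⟦⟧-cong eq) i)

  τ-homo : ∀ x y i → τ (λ i → x i ℤ.+ y i) i ≡ τ x i ℤ.+ τ y i
  τ-homo x y i = trans
    (cong (λ z → (x i ℤ.+ y i) ℤ.- z) (trans (σ.⟦⟧-cong (π.homo x y) i) (σ.homo (⟦ π ⟧ x) (⟦ π ⟧ y) i)))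
    (interchange (x i) (y i) _ _)
    where
    interchange : ∀ a b c d → (a ℤ.+ b) ℤ.- (c ℤ.+ d) ≡ (a ℤ.- c) ℤ.+ (b ℤ.- d)
    interchange = ℤ-Solver.solve-∀

  π∘τ : ∀ x i → ⟦ π ⟧ (τ x) i ≡ 0ℤ
  π∘τ x i = begin
    ⟦ π ⟧ (τ x) i                                          ≡⟨ π.homo x _ i ⟩
    ⟦ π ⟧ x i ℤ.+ ⟦ π ⟧ (λ j → ℤ.- ⟦ σ ⟧ (⟦ π ⟧ x) j) i    ≡⟨ cong (λ z → ⟦ π ⟧ x i ℤ.+ z) (π.⁻¹-homo (⟦ σ ⟧ (⟦ π ⟧ x)) i) ⟩
    ⟦ π ⟧ x i ℤ.- ⟦ π ⟧ (⟦ σ ⟧ (⟦ π ⟧ x)) i                ≡⟨ cong (λ z → ⟦ π ⟧ x i ℤ.- z) (π∘σ (⟦ π ⟧ x) i) ⟩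
    ⟦ π ⟧ x i ℤ.- ⟦ π ⟧ x i                                ≡⟨ ℤ.+-inverseʳ (⟦ π ⟧ x i) ⟩
    0ℤ                                                     ∎
    where open ≡-Reasoning

  τ-fixes : ∀ {x} → (∀ i → ⟦ π ⟧ x i ≡ 0ℤ) → ∀ i → τ x i ≡ x i
  τ-fixes {x} πx≗0 i = trans
    (cong (λ z → x i ℤ.- z) (trans (σ.⟦⟧-cong {y = 0ⱽ} πx≗0 i) (σ.ε-homo i))) (ℤ.+-identityʳ (x i))

  τ∘σ : ∀ y i → τ (⟦ σ ⟧ y) i ≡ 0ℤ
  τ∘σ y i = trans (cong (λ z → ⟦ σ ⟧ y i ℤ.- z) (σ.⟦⟧-cong (π∘σ y) i)) (ℤ.+-inverseʳ (⟦ σ ⟧ y i))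

  decompose : ∀ x i → x i ≡ τ x i ℤ.+ ⟦ σ ⟧ (⟦ π ⟧ x) i
  decompose x i = sym (cancel (x i) _)
    where
    cancel : ∀ a b → (a ℤ.- b) ℤ.+ b ≡ a
    cancel = ℤ-Solver.solve-∀

  π-Generated : ∀ {x} → Generated (ℤ^ n) P x → ∀ i → ⟦ π ⟧ x i ≡ 0ℤ
  π-Generated = Generated-kernel (ℤ^ corank) π π-P

  module _ (r : ℕ) (iso : generatedSubgroup (ℤ^ n) P ≅ (ℤ^ r)) where
    private
      N = generatedSubgroup (ℤ^ n) P
      module N = AbelianGroup N
      f = proj₁ iso
      module f = IsGroupIsomorphism (proj₂ iso)

      preimage : Vectorℤ r → N.Carrier
      preimage y = proj₁ (f.surjective y)

      f∘preimage : ∀ y i → f (preimage y) i ≡ y i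
      f∘preimage y = proj₂ (f.surjective y) {preimage y} (λ _ → refl)

      preimage-cong : ∀ {x y} → (∀ i → x i ≡ y i) → preimage x N.≈ preimage y
      preimage-cong {x} {y} eq = f.injective {preimage x} {preimage y}
        (λ i → trans (f∘preimage x i) (trans (eq i) (sym (f∘preimage y i))))

      preimage-homo : ∀ x y → preimage (λ i → x i ℤ.+ y i) N.≈ (preimage x N.∙ preimage y)
      preimage-homo x y = f.injective {preimage (λ i → x i ℤ.+ y i)} {preimage x N.∙ preimage y}
        (λ i → trans (f∘preimage _ i)
          (sym (trans (f.∙-homo (preimage x) (preimage y) i) (cong₂ ℤ._+_ (f∘preimage x i) (f∘preimage y i)))))

    -- The map (y, z) ↦ σ y + f⁻¹ z has trivial kernel: π kills ⟨P⟩ and inverts σ, so it recovers y,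
    -- and applying f to the rest recovers z.
    corank+rank≤n : corank ℕ.+ r ℕ.≤ n
    corank+rank≤n = trivialKernel⇒≤ (corank ℕ.+ r) n embedding kernel
      where
      left : Vectorℤ (corank ℕ.+ r) → Vectorℤ corank
      left x i = x (i Fin.↑ˡ r)
      right : Vectorℤ (corank ℕ.+ r) → Vectorℤ r
      right x i = x (corank Fin.↑ʳ i)
      value : Vectorℤ (corank ℕ.+ r) → Vectorℤ n
      value x i = ⟦ σ ⟧ (left x) i ℤ.+ proj₁ (preimage (right x)) i
      interchange : ∀ a b c d → (a ℤ.+ b) ℤ.+ (c ℤ.+ d) ≡ (a ℤ.+ c) ℤ.+ (b ℤ.+ d)
      interchange = ℤ-Solver.solve-∀
      embedding : Hom (ℤ^ (corank ℕ.+ r)) (ℤ^ n)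
      embedding = mkHom (ℤ^ (corank ℕ.+ r)) (ℤ^ n) value
        (λ {x} {y} eq i → cong₂ ℤ._+_ (σ.⟦⟧-cong (λ j → eq (j Fin.↑ˡ r)) i)
          (preimage-cong {right x} {right y} (λ j → eq (corank Fin.↑ʳ j)) i))
        (λ x y i → trans
          (cong₂ ℤ._+_ (σ.homo (left x) (left y) i) (preimage-homo (right x) (right y) i))
          (interchange (⟦ σ ⟧ (left x) i) (⟦ σ ⟧ (left y) i) _ _))
      module _ (x : Vectorℤ (corank ℕ.+ r)) (x↦0 : ∀ i → value x i ≡ 0ℤ) where
        left≗0 : ∀ i → left x i ≡ 0ℤ
        left≗0 i = begin
          left x i                                                               ≡⟨ ℤ.+-identityʳ (left x i) ⟨
          left x i ℤ.+ 0ℤ                                                        ≡⟨ cong₂ ℤ._+_ (π∘σ (left x) i) (π-Generated (proj₂ (preimage (right x))) i) ⟨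
          ⟦ π ⟧ (⟦ σ ⟧ (left x)) i ℤ.+ ⟦ π ⟧ (proj₁ (preimage (right x))) i      ≡⟨ π.homo _ _ i ⟨
          ⟦ π ⟧ (value x) i                                                      ≡⟨ π.⟦⟧-cong {y = 0ⱽ} x↦0 i ⟩
          ⟦ π ⟧ 0ⱽ i                                                             ≡⟨ π.ε-homo i ⟩
          0ℤ                                                                     ∎
          where open ≡-Reasoning
        preimage≈0 : preimage (right x) N.≈ N.ε
        preimage≈0 i = begin
          proj₁ (preimage (right x)) i ≡⟨ ℤ.+-identityˡ _ ⟨
          0ℤ ℤ.+ proj₁ (preimage (right x)) i
            ≡⟨ cong (ℤ._+ proj₁ (preimage (right x)) i) (trans (σ.⟦⟧-cong {y = 0ⱽ} left≗0 i) (σ.ε-homo i)) ⟨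
          value x i ≡⟨ x↦0 i ⟩
          0ℤ ∎
          where open ≡-Reasoning
        right≗0 : ∀ i → right x i ≡ 0ℤ
        right≗0 i = trans (sym (f∘preimage (right x) i))
          (trans (f.⟦⟧-cong {preimage (right x)} {N.ε} preimage≈0 i) (f.ε-homo i))
        kernel′ : ∀ i → x i ≡ 0ℤ
        kernel′ i with Fin.splitAt corank i in eq
        ... | inj₁ j = subst (λ i → x i ≡ 0ℤ) (Fin.splitAt⁻¹-↑ˡ eq) (left≗0 j)
        ... | inj₂ j = subst (λ i → x i ≡ 0ℤ) (Fin.splitAt⁻¹-↑ʳ {corank} eq) (right≗0 j)
      kernel : TrivialKernel embedding
      kernel = kernel′

    -- The map x ↦ (π x, f (c τ x)) has trivial kernel. One c has to serve all of ker π: the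
    -- multiplier given by `ker-π` varies with x, and with it f (c τ x) might not be additive in x.
    n≤corank+rank : ∀ c → c ≢ 0ℤ →
      (∀ {x} → (∀ i → ⟦ π ⟧ x i ≡ 0ℤ) → Generated (ℤ^ n) P (c ⊙ x)) → n ℕ.≤ corank ℕ.+ r
    n≤corank+rank c c≢0 saturates = trivialKernel⇒≤ n (corank ℕ.+ r) embedding kernel
      where
      member : Vectorℤ n → N.Carrier
      member x = c ⊙ τ x , saturates (π∘τ x)
      fmember : Hom (ℤ^ n) (ℤ^ r)
      fmember = mkHom (ℤ^ n) (ℤ^ r) (f ∘ member)
        (λ {x} {y} eq → f.⟦⟧-cong {member x} {member y} (λ i → cong (c ℤ.*_) (τ-cong eq i)))
        (λ x y i → trans
          (f.⟦⟧-cong {member (λ i → x i ℤ.+ y i)} {member x N.∙ member y}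
            (λ j → trans (cong (c ℤ.*_) (τ-homo x y j)) (ℤ.*-distribˡ-+ c (τ x j) (τ y j))) i)
          (f.∙-homo (member x) (member y) i))
      embedding : Hom (ℤ^ n) (ℤ^ (corank ℕ.+ r))
      embedding = mkHom (ℤ^ n) (ℤ^ (corank ℕ.+ r)) (λ x → ⟦ π ⟧ x ++ᶠ f (member x))
        (λ {x} {y} eq i → embedding-cong {x} {y} eq (Fin.splitAt corank i))
        (λ x y i → embedding-homo x y (Fin.splitAt corank i))
        where
        embedding-cong : ∀ {x y} → (∀ i → x i ≡ y i) → ∀ i →
          [ ⟦ π ⟧ x , f (member x) ]′ i ≡ [ ⟦ π ⟧ y , f (member y) ]′ i
        embedding-cong eq (inj₁ i) = π.⟦⟧-cong eq i
        embedding-cong eq (inj₂ i) = GroupHomomorphism.⟦⟧-cong fmember eq i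
        embedding-homo : ∀ x y i → [ ⟦ π ⟧ (λ i → x i ℤ.+ y i) , f (member (λ i → x i ℤ.+ y i)) ]′ i ≡
          [ ⟦ π ⟧ x , f (member x) ]′ i ℤ.+ [ ⟦ π ⟧ y , f (member y) ]′ i
        embedding-homo x y (inj₁ i) = π.homo x y i
        embedding-homo x y (inj₂ i) = GroupHomomorphism.homo fmember x y i
      kernel : TrivialKernel embedding
      kernel x x↦0 i = trans (decompose x i) (cong₂ ℤ._+_ τx≡0 (trans (σ.⟦⟧-cong {y = 0ⱽ} πx≗0 i) (σ.ε-homo i)))
        where
        πx≗0 : ∀ j → ⟦ π ⟧ x j ≡ 0ℤ
        πx≗0 j = trans (sym (lookup-++ˡ (⟦ π ⟧ x) (f (member x)) j)) (x↦0 (j Fin.↑ˡ r))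
        member≈0 : member x N.≈ N.ε
        member≈0 = f.injective {member x} {N.ε} (λ j → trans
          (sym (lookup-++ʳ (⟦ π ⟧ x) (f (member x)) j)) (trans (x↦0 (corank Fin.↑ʳ j)) (sym (f.ε-homo j))))
        τx≡0 : τ x i ≡ 0ℤ
        τx≡0 with ℤ.i*j≡0⇒i≡0∨j≡0 c (member≈0 i)
        ... | inj₁ c≡0  = contradiction c≡0 c≢0
        ... | inj₂ τx≡0 = τx≡0

    corank≡n∸rank : ∀ c → c ≢ 0ℤ →
      (∀ {x} → (∀ i → ⟦ π ⟧ x i ≡ 0ℤ) → Generated (ℤ^ n) P (c ⊙ x)) → corank ≡ n ∸ r
    corank≡n∸rank c c≢0 saturates = trans (sym (ℕ.m+n∸n≡m corank r))
      (cong (_∸ r) (ℕ.≤-antisym corank+rank≤n (n≤corank+rank c c≢0 saturates)))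

-- Torsion of ℤⁿ/⟨P⟩ and its invariant factors

module _ (G : Ab) where
  open RawMonoidDefinitions (AbelianGroup.rawMonoid G) using () renaming (_×_ to _·_) public

hom-· : ∀ (G H : Ab) (φ : Hom G H) m x →
  AbelianGroup._≈_ H (⟦ φ ⟧ (_·_ G m x)) (_·_ H m (⟦ φ ⟧ x))
hom-· G H φ zero    x = GroupHomomorphism.ε-homo φ
hom-· G H φ (suc m) x = H.trans (GroupHomomorphism.homo φ x (_·_ G m x)) (H.∙-congˡ (hom-· G H φ m x))
  where module H = AbelianGroup H

module _ {n : ℕ} (P : Pred (Vectorℤ n) 0ℓ) where

  Quotient Torsion : Ab
  Quotient = quotient (ℤ^ n) P
  Torsion  = torsionSubgroup Quotient

  ·-quotient : ∀ m x i → _·_ Quotient m x i ≡ + m ℤ.* x i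
  ·-quotient zero    x i = refl
  ·-quotient (suc m) x i = trans (cong (λ z → x i ℤ.+ z) (·-quotient m x i)) (sym (ℤ.suc-* (+ m) (x i)))

  ·-torsion : ∀ m t i → proj₁ (_·_ Torsion m t) i ≡ + m ℤ.* proj₁ t i
  ·-torsion zero    t i = refl
  ·-torsion (suc m) t i = trans (cong (λ z → proj₁ t i ℤ.+ z) (·-torsion m t i)) (sym (ℤ.suc-* (+ m) (proj₁ t i)))

  ≈ε⇒Generated : ∀ {x} → AbelianGroup._≈_ Quotient x 0ⱽ → Generated (ℤ^ n) P x
  ≈ε⇒Generated = resp (λ i → ℤ.+-identityʳ _)

  Generated⇒≈ε : ∀ {x} → Generated (ℤ^ n) P x → AbelianGroup._≈_ Quotient x 0ⱽ
  Generated⇒≈ε = resp (λ i → sym (ℤ.+-identityʳ _))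

  ≗⇒≈ : ∀ {x y} → (∀ i → x i ≡ y i) → AbelianGroup._≈_ Quotient x y
  ≗⇒≈ {x} {y} eq = resp {x = 0ⱽ} (λ i → sym (ℤ.i≡j⇒i-j≡0 (eq i))) ε∈

  saturated⇒torsion : ∀ {x} c → c ≢ 0ℤ → Generated (ℤ^ n) P (c ⊙ x) → IsTorsion Quotient x
  saturated⇒torsion {x} (+ m)    c≢0 g = m , ℕ.≢-nonZero (c≢0 ∘ cong +_) ,
    Generated⇒≈ε (resp (λ i → sym (·-quotient m x i)) g)
  saturated⇒torsion {x} -[1+ m ] c≢0 g = suc m , _ ,
    Generated⇒≈ε (resp (λ i → trans (ℤ.neg-distribˡ-* -[1+ m ] (x i)) (sym (·-quotient (suc m) x i))) (⁻¹∈ g))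

  ker-π⇒torsion : (s : Splitting P) → ∀ {x} → (∀ i → ⟦ Splitting.π s ⟧ x i ≡ 0ℤ) → IsTorsion Quotient x
  ker-π⇒torsion s πx≗0 = let c , c≢0 , g = Splitting.ker-π s πx≗0 in saturated⇒torsion c c≢0 g

  -- Some nonzero multiple of x lies in ⟨P⟩, which π kills, and the target of π is torsion-free.
  -- Together with `ker-π⇒torsion`, this makes ker π the preimage of the torsion subgroup.
  torsion⇒ker-π : (s : Splitting P) → ∀ {x} → IsTorsion Quotient x → ∀ i → ⟦ Splitting.π s ⟧ x i ≡ 0ℤ
  torsion⇒ker-π s {x} (m , m≢0 , mx≈0) i with ℤ.i*j≡0⇒i≡0∨j≡0 (+ m) (trans
    (sym (⟦⟧-⊙ π (+ m) x i)) (π-Generated s (resp (·-quotient m x) (≈ε⇒Generated mx≈0)) i))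
    where open Splitting s
  ... | inj₁ m≡0  = contradiction (ℤ.+-injective m≡0) (ℕ.≢-nonZero⁻¹ m {{m≢0}})
  ... | inj₂ πx≡0 = πx≡0

-- Comparability turns the numerical maximum into a common multiple: x is at most the maximum, so if
-- the maximum divides x the two are equal. If the maximum is the default 1, the positive x is
-- itself 1.
comparable-max : ∀ {x ds} → x ∈ ds → (∀ {y} → y ∈ ds → (x ∣ y) ⊎ (y ∣ x)) → NonZero x → x ∣ max 1 ds
comparable-max {x} {ds} x∈ds comparable x≢0 with argmax-sel id 1 ds
... | inj₁ max≡1 = subst (x ∣_) (sym max≡1) (ℕ∣.∣-reflexive
  (ℕ.≤-antisym (ℕ.≤-trans (All.lookup (xs≤max 1 ds) x∈ds) (ℕ.≤-reflexive max≡1)) (ℕ.>-nonZero⁻¹ x {{x≢0}})))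
... | inj₂ max∈ds with comparable max∈ds
...   | inj₁ x∣max = x∣max
...   | inj₂ max∣x = ℕ∣.∣-reflexive
  (ℕ.≤-antisym (All.lookup (xs≤max 1 ds) x∈ds) (ℕ∣.∣⇒≤ {{x≢0}} max∣x))

chain-comparable : ∀ {ds} → AllPairs _∣_ ds → ∀ {x y} → x ∈ ds → y ∈ ds → (x ∣ y) ⊎ (y ∣ x)
chain-comparable (_ ∷ _)  (here refl) (here refl) = inj₁ ℕ∣.∣-refl
chain-comparable (h ∷ _)  (here refl) (there y∈)  = inj₁ (All.lookup h y∈)
chain-comparable (h ∷ _)  (there x∈)  (here refl) = inj₂ (All.lookup h x∈)
chain-comparable (_ ∷ hs) (there x∈)  (there y∈)  = chain-comparable hs x∈ y∈

factors∣largest : ∀ {ds} → All NonZero ds → Linked _∣_ ds → All (_∣ max 1 ds) ds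
factors∣largest positive chain = All.tabulate λ x∈ds → comparable-max x∈ds
  (chain-comparable (Linked⇒AllPairs ℕ∣.∣-trans chain) x∈ds) (All.lookup positive x∈ds)

·-ℤ/ : ∀ d m a → _·_ (ℤ/ d) m a ≡ + m ℤ.* a
·-ℤ/ d zero    a = refl
·-ℤ/ d (suc m) a = trans (cong (λ z → a ℤ.+ z) (·-ℤ/ d m a)) (sym (ℤ.suc-* (+ m) a))

·-⨁ : ∀ d ds m a b → _·_ (⨁ℤ/ (d ∷ ds)) m (a , b) ≡ (_·_ (ℤ/ d) m a , _·_ (⨁ℤ/ ds) m b)
·-⨁ d ds zero    a b = refl
·-⨁ d ds (suc m) a b = cong (AbelianGroup._∙_ (⨁ℤ/ (d ∷ ds)) (a , b)) (·-⨁ d ds m a b)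

⨁-exponent : ∀ {ρ} ds → All (_∣ ρ) ds → ∀ y →
  AbelianGroup._≈_ (⨁ℤ/ ds) (_·_ (⨁ℤ/ ds) ρ y) (AbelianGroup.ε (⨁ℤ/ ds))
⨁-exponent []       []           y       = _
⨁-exponent {ρ} (d ∷ ds) (d∣ρ ∷ ds∣ρ) (a , b) rewrite ·-⨁ d ds ρ a b | ·-ℤ/ d ρ a =
  ∣⇒≈0 d {+ ρ ℤ.* a} (ℤ∣.∣m⇒∣m*n {m = + ρ} a (ℤ∣.∣ᵤ⇒∣ d∣ρ)) , ⨁-exponent ds ds∣ρ b

-- Each factor divides the largest one, so ρ kills every cyclic summand; injectivity of the
-- isomorphism brings this back to G.
isomorphism-exponent : ∀ {G ds ρ} → InvariantFactors G ds → max 1 ds ∣ ρ →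
  ∀ t → AbelianGroup._≈_ G (_·_ G ρ t) (AbelianGroup.ε G)
isomorphism-exponent {G} {ds} {ρ} F largest∣ρ t = f.injective (H.trans (hom-· G H φ ρ t)
  (H.trans (⨁-exponent ds (All.map (λ d∣ → ℕ∣.∣-trans d∣ largest∣ρ) (factors∣largest positive divisibility)) (f t))
    (H.sym f.ε-homo)))
  where
  open InvariantFactors F
  H = ⨁ℤ/ ds
  module H = AbelianGroup H
  f = proj₁ decomposition
  module f = IsGroupIsomorphism (proj₂ decomposition)
  φ : Hom G H
  φ = record { ⟦_⟧ = f ; isGroupHomomorphism = f.isGroupHomomorphism }

∣foldr-lcm : ∀ {x xs} → x ∈ xs → x ∣ foldr lcm 1 xs
∣foldr-lcm {xs = y ∷ ys} (here refl) = m∣lcm[m,n] y (foldr lcm 1 ys)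
∣foldr-lcm {xs = y ∷ ys} (there x∈)  = ℕ∣.∣-trans (∣foldr-lcm x∈) (n∣lcm[m,n] y (foldr lcm 1 ys))

lcm-nonZero : ∀ m n → NonZero m → NonZero n → NonZero (lcm m n)
lcm-nonZero m n m≢0 n≢0 = ℕ.≢-nonZero λ lcm≡0 → ℕ.≢-nonZero⁻¹ (m ℕ.* n) {{ℕ.m*n≢0 m n {{m≢0}} {{n≢0}}}}
  (trans (sym (gcd*lcm m n)) (trans (cong (gcd m n ℕ.*_) lcm≡0) (ℕ.*-zeroʳ (gcd m n))))

foldr-lcm-nonZero : ∀ {xs} → All NonZero xs → NonZero (foldr lcm 1 xs)
foldr-lcm-nonZero []                          = _
foldr-lcm-nonZero {x ∷ xs} (x≢0 ∷ xs≢0) = lcm-nonZero x (foldr lcm 1 xs) x≢0 (foldr-lcm-nonZero xs≢0)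

∈-allSubsets : ∀ {n} (S : Subset n) → S ∈ allSubsets n
∈-allSubsets []            = here refl
∈-allSubsets (outside ∷ S) = ∈-++⁺ˡ (∈-map⁺ (outside ∷_) (∈-allSubsets S))
∈-allSubsets (inside ∷ S)  = ∈-++⁺ʳ (map (outside ∷_) (allSubsets _)) (∈-map⁺ (inside ∷_) (∈-allSubsets S))

module _ {ℓ} {A : List (Vectorℤ ℓ)} {ρ} (period : IsLCMPeriod A ρ) where
  open IsLCMPeriod period

  -- The default 1 in the maximum keeps every term of the lcm positive, also for trivial torsion.
  period-nonZero : NonZero ρ
  period-nonZero = subst NonZero (sym isLCM)
    (foldr-lcm-nonZero (map⁺ (All.universal (λ S → ℕ.>-nonZero (⊥≤max 1 (d S))) (sublists A))))

  -- ρ is a multiple of the largest invariant factor for every S. This supplies the uniform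
  -- multiplier that `corank≡n∸rank` asks for, and it restricts the images of tor in ℤ/q.
  period-exponent : ∀ S t → Generated (ℤ^ ℓ) (Members A S) (+ ρ ⊙ proj₁ {B = IsTorsion (quotient (ℤ^ ℓ) (Members A S))} t)
  period-exponent S t = resp (·-torsion (Members A S) ρ t) (≈ε⇒Generated (Members A S)
    (isomorphism-exponent (invariantFactors S) largest∣ρ t))
    where
    largest∣ρ : max 1 (d S) ∣ ρ
    largest∣ρ = subst (max 1 (d S) ∣_) (sym isLCM)
      (∣foldr-lcm (∈-map⁺ (λ S → max 1 (d S)) (∈-allSubsets S)))

-- Counting homomorphisms

module _ (e k : ℕ) {{e≢0 : NonZero e}} {{k≢0 : NonZero k}} where
  private
    module ℤ/ek = AbelianGroup (ℤ/ (e ℕ.* k))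
    module ℤ/k = AbelianGroup (ℤ/ k)
    instance
      +e≢0 : ℤ.NonZero (+ e)
      +e≢0 = e≢0
      +k≢0 : ℤ.NonZero (+ k)
      +k≢0 = k≢0

    distrib : ∀ e a b → e ℤ.* (a ℤ.- b) ≡ e ℤ.* a ℤ.- e ℤ.* b
    distrib = ℤ-Solver.solve-∀

  scale-≈ : ∀ {a b} → a ℤ/k.≈ b → (+ e ℤ.* a) ℤ/ek.≈ (+ e ℤ.* b)
  scale-≈ {a} {b} a≈b = ℤ∣.∣-trans (ℤ∣.∣-reflexive (ℤ.pos-* e k))
    (subst (+ e ℤ.* + k ∣ℤ_) (distrib (+ e) a b) (ℤ∣.*-monoʳ-∣ (+ e) a≈b))

  unscale-≈ : ∀ {a b} → (+ e ℤ.* a) ℤ/ek.≈ (+ e ℤ.* b) → a ℤ/k.≈ b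
  unscale-≈ {a} {b} ea≈eb = ℤ∣.*-cancelˡ-∣ (+ e)
    (subst (+ e ℤ.* + k ∣ℤ_) (sym (distrib (+ e) a b)) (ℤ∣.∣-trans (ℤ∣.∣-reflexive (sym (ℤ.pos-* e k))) ea≈eb))

  -- ℤ/k is embedded in ℤ/ek as the k-torsion, via multiplication by e.
  Hom-k-torsion : (T : Ab) →
    (∀ (φ : Hom T (ℤ/ (e ℕ.* k))) t → + (e ℕ.* k) ∣ℤ + k ℤ.* ⟦ φ ⟧ t) →
    Inverse (HomSetoid T (ℤ/ (e ℕ.* k))) (HomSetoid T (ℤ/ k))
  Hom-k-torsion T k-torsion = mkInverse quotientHom scaledHom
    (λ {φ} {ψ} φ≈ψ t → unscale-≈ (rewrite-quotients φ ψ t t (φ≈ψ t)))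
    (λ {φ} {ψ} φ≈ψ t → scale-≈ (φ≈ψ t))
    (λ ψ t → unscale-≈ (ℤ/ek.reflexive (sym (quotient-eq (scaledHom ψ) t))))
    (λ φ t → ℤ/ek.reflexive (sym (quotient-eq φ t)))
    where
    module T = AbelianGroup T
    e∣ : (φ : Hom T (ℤ/ (e ℕ.* k))) → ∀ t → + e ∣ℤ ⟦ φ ⟧ t
    e∣ φ t = ℤ∣.*-cancelʳ-∣ (+ k) (subst (_∣ℤ ⟦ φ ⟧ t ℤ.* + k) (ℤ.pos-* e k)
      (subst (+ (e ℕ.* k) ∣ℤ_) (ℤ.*-comm (+ k) (⟦ φ ⟧ t)) (k-torsion φ t)))
    quot : Hom T (ℤ/ (e ℕ.* k)) → T.Carrier → ℤ
    quot φ t = ℤ∣._∣_.quotient (e∣ φ t)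
    quotient-eq : ∀ φ t → ⟦ φ ⟧ t ≡ + e ℤ.* quot φ t
    quotient-eq φ t = trans (ℤ∣._∣_.equality (e∣ φ t)) (ℤ.*-comm (quot φ t) (+ e))
    rewrite-quotients : ∀ φ ψ t u → ⟦ φ ⟧ t ℤ/ek.≈ ⟦ ψ ⟧ u → (+ e ℤ.* quot φ t) ℤ/ek.≈ (+ e ℤ.* quot ψ u)
    rewrite-quotients φ ψ t u = subst₂ ℤ/ek._≈_ (quotient-eq φ t) (quotient-eq ψ u)
    quotientHom : Hom T (ℤ/ (e ℕ.* k)) → Hom T (ℤ/ k)
    -- The integers `quot φ t` are additive only modulo k: φ is additive modulo e k, and the
    -- congruence is divided by e.
    quotientHom φ = mkHom T (ℤ/ k) (quot φ)
      (λ {t} {u} t≈u → unscale-≈ (rewrite-quotients φ φ t u (φ.⟦⟧-cong t≈u)))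
      (λ t u → unscale-≈ (subst₂ ℤ/ek._≈_ (quotient-eq φ (t T.∙ u))
        (trans (cong₂ ℤ._+_ (quotient-eq φ t) (quotient-eq φ u)) (sym (ℤ.*-distribˡ-+ (+ e) (quot φ t) (quot φ u))))
        (φ.homo t u)))
      where module φ = GroupHomomorphism φ
    scaledHom : Hom T (ℤ/ k) → Hom T (ℤ/ (e ℕ.* k))
    scaledHom ψ = mkHom T (ℤ/ (e ℕ.* k)) (λ t → + e ℤ.* ⟦ ψ ⟧ t)
      (λ t≈u → scale-≈ (ψ.⟦⟧-cong t≈u))
      (λ t u → ℤ/ek.trans {+ e ℤ.* ⟦ ψ ⟧ (t T.∙ u)} (scale-≈ (ψ.homo t u))
        (ℤ/ek.reflexive (ℤ.*-distribˡ-+ (+ e) (⟦ ψ ⟧ t) (⟦ ψ ⟧ u))))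
      where module ψ = GroupHomomorphism ψ

module _ {n} {P : Pred (Vectorℤ n) 0ℓ} (s : Splitting P) (q : ℕ) where
  open Splitting s
  private
    module G = AbelianGroup (ℤ/ q)
    module T = AbelianGroup (Torsion P)

    sumHom : ∀ (H : Ab) → Hom H (ℤ/ q) → Hom H (ℤ/ q) → Hom H (ℤ/ q)
    sumHom H φ ψ = mkHom H (ℤ/ q) (λ x → ⟦ φ ⟧ x ℤ.+ ⟦ ψ ⟧ x)
      (λ {x} {y} x≈y → G.∙-cong {⟦ φ ⟧ x} {⟦ φ ⟧ y} {⟦ ψ ⟧ x} {⟦ ψ ⟧ y} (φ.⟦⟧-cong x≈y) (ψ.⟦⟧-cong x≈y))
      (λ x y → G.trans {⟦ φ ⟧ (x H.∙ y) ℤ.+ ⟦ ψ ⟧ (x H.∙ y)} {(⟦ φ ⟧ x ℤ.+ ⟦ φ ⟧ y) ℤ.+ (⟦ ψ ⟧ x ℤ.+ ⟦ ψ ⟧ y)}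
        (G.∙-cong {⟦ φ ⟧ (x H.∙ y)} {⟦ φ ⟧ x ℤ.+ ⟦ φ ⟧ y} {⟦ ψ ⟧ (x H.∙ y)} {⟦ ψ ⟧ x ℤ.+ ⟦ ψ ⟧ y} (φ.homo x y) (ψ.homo x y))
        (G.reflexive (interchange (⟦ φ ⟧ x) (⟦ φ ⟧ y) (⟦ ψ ⟧ x) (⟦ ψ ⟧ y))))
      where
      module H = AbelianGroup H
      module φ = GroupHomomorphism φ
      module ψ = GroupHomomorphism ψ
      interchange : ∀ a b c d → (a ℤ.+ b) ℤ.+ (c ℤ.+ d) ≡ (a ℤ.+ c) ℤ.+ (b ℤ.+ d)
      interchange = ℤ-Solver.solve-∀

    torsionPart : Hom (ℤ^ n) (Torsion P)
    torsionPart = mkHom (ℤ^ n) (Torsion P) (λ x → τ s x , ker-π⇒torsion P s (π∘τ s x))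
      (λ eq → ≗⇒≈ P (τ-cong s eq)) (λ x y → ≗⇒≈ P (τ-homo s x y))

  -- ℤⁿ is the direct sum of ker π and the image of σ. On ker π, a homomorphism that kills P is one
  -- on ker π modulo ⟨P⟩, the torsion group; on the free complement it is any choice of values on a
  -- basis. The inverse glues the two as x ↦ ψ(τ x) + v · π x.
  Hom-splitting : Inverse
    (subsetoid (HomSetoid (ℤ^ n) (ℤ/ q)) (λ φ → ∀ x → P x → ⟦ φ ⟧ x G.≈ 0ℤ))
    (×-setoid (HomSetoid (Torsion P) (ℤ/ q)) (≋-setoid G.setoid corank))
  Hom-splitting = mkInverse
    (λ (φ , kills) → restrict φ kills , λ i → ⟦ φ ⟧ (⟦ σ ⟧ (basis i)))
    (λ (ψ , v) → extend ψ v , extend-kills ψ v)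
    (λ φ≈φ′ → (λ t → φ≈φ′ (proj₁ t)) , (λ i → φ≈φ′ (⟦ σ ⟧ (basis i))))
    (λ { {ψ , v} {ψ′ , v′} (ψ≈ψ′ , v≈v′) x →
      G.∙-cong {⟦ ψ ⟧ (⟦ torsionPart ⟧ x)} {⟦ ψ′ ⟧ (⟦ torsionPart ⟧ x)} {dot v (⟦ π ⟧ x)} {dot v′ (⟦ π ⟧ x)}
        (ψ≈ψ′ (⟦ torsionPart ⟧ x)) (Inverse.from-cong (Hom-ℤⁿ q corank) {v} {v′} v≈v′ (⟦ π ⟧ x)) })
    (λ (ψ , v) → extend-torsion ψ v , extend-σ ψ v)
    (λ (φ , kills) x → let v = λ i → ⟦ φ ⟧ (⟦ σ ⟧ (basis i)) in
      G.trans {⟦ φ ⟧ (τ s x) ℤ.+ dot v (⟦ π ⟧ x)} {⟦ φ ⟧ (τ s x) ℤ.+ ⟦ φ ⟧ (⟦ σ ⟧ (⟦ π ⟧ x))} {⟦ φ ⟧ x}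
        (G.∙-congˡ {⟦ φ ⟧ (τ s x)} {dot v (⟦ π ⟧ x)} {⟦ φ ⟧ (⟦ σ ⟧ (⟦ π ⟧ x))}
          (from∘to (Hom-ℤⁿ q corank) (compose (ℤ^ corank) (ℤ^ n) (ℤ/ q) φ σ) (⟦ π ⟧ x)))
        (G.sym {⟦ φ ⟧ x} (G.trans {⟦ φ ⟧ x} {⟦ φ ⟧ (λ i → τ s x i ℤ.+ ⟦ σ ⟧ (⟦ π ⟧ x) i)}
          (GroupHomomorphism.⟦⟧-cong φ (decompose s x))
          (GroupHomomorphism.homo φ (τ s x) (⟦ σ ⟧ (⟦ π ⟧ x))))))
    where
    restrict : (φ : Hom (ℤ^ n) (ℤ/ q)) → (∀ x → P x → ⟦ φ ⟧ x G.≈ 0ℤ) → Hom (Torsion P) (ℤ/ q)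
    restrict φ kills = mkHom (Torsion P) (ℤ/ q) (λ t → ⟦ φ ⟧ (proj₁ t))
      (λ {t} {u} t≈u → x∙y⁻¹≈ε⇒x≈y (⟦ φ ⟧ (proj₁ t)) (⟦ φ ⟧ (proj₁ u))
        (G.trans {⟦ φ ⟧ (proj₁ t) ℤ.- ⟦ φ ⟧ (proj₁ u)} {⟦ φ ⟧ (λ i → proj₁ t i ℤ.- proj₁ u i)} {0ℤ}
          (G.sym {⟦ φ ⟧ (λ i → proj₁ t i ℤ.- proj₁ u i)}
            (G.trans {⟦ φ ⟧ (λ i → proj₁ t i ℤ.- proj₁ u i)} {⟦ φ ⟧ (proj₁ t) ℤ.+ ⟦ φ ⟧ (λ i → ℤ.- proj₁ u i)}
              (φ.homo (proj₁ t) _)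
              (G.∙-congˡ {⟦ φ ⟧ (proj₁ t)} {⟦ φ ⟧ (λ i → ℤ.- proj₁ u i)} {ℤ.- ⟦ φ ⟧ (proj₁ u)}
                (φ.⁻¹-homo (proj₁ u)))))
          (Generated-kernel (ℤ/ q) φ (λ {x} → kills x) t≈u)))
      (λ t u → φ.homo (proj₁ t) (proj₁ u))
      where
      module φ = GroupHomomorphism φ
      open GroupProperties G.group using (x∙y⁻¹≈ε⇒x≈y)

    extend : Hom (Torsion P) (ℤ/ q) → Vectorℤ corank → Hom (ℤ^ n) (ℤ/ q)
    extend ψ v = sumHom (ℤ^ n) (compose (ℤ^ n) (Torsion P) (ℤ/ q) ψ torsionPart)
      (compose (ℤ^ n) (ℤ^ corank) (ℤ/ q) (dotHom q v) π)

    extend-torsion : ∀ ψ v t → ⟦ extend ψ v ⟧ (proj₁ t) G.≈ ⟦ ψ ⟧ t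
    extend-torsion ψ v t =
      G.trans {⟦ extend ψ v ⟧ (proj₁ t)} {⟦ ψ ⟧ t ℤ.+ 0ℤ} {⟦ ψ ⟧ t}
        (G.∙-cong {⟦ ψ ⟧ (⟦ torsionPart ⟧ (proj₁ t))} {⟦ ψ ⟧ t} {dot v (⟦ π ⟧ (proj₁ t))} {0ℤ}
          (GroupHomomorphism.⟦⟧-cong ψ {⟦ torsionPart ⟧ (proj₁ t)} {t} (≗⇒≈ P (τ-fixes s πt≗0)))
          (G.reflexive (dot-0 v πt≗0)))
        (G.identityʳ (⟦ ψ ⟧ t))
      where πt≗0 = torsion⇒ker-π P s (proj₂ t)

    extend-σ : ∀ ψ v i → ⟦ extend ψ v ⟧ (⟦ σ ⟧ (basis i)) G.≈ v i
    extend-σ ψ v i =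
      G.trans {⟦ extend ψ v ⟧ (⟦ σ ⟧ (basis i))} {0ℤ ℤ.+ v i} {v i}
        (G.∙-cong {⟦ ψ ⟧ (⟦ torsionPart ⟧ (⟦ σ ⟧ (basis i)))} {0ℤ} {dot v (⟦ π ⟧ (⟦ σ ⟧ (basis i)))} {v i}
          (G.trans {⟦ ψ ⟧ (⟦ torsionPart ⟧ (⟦ σ ⟧ (basis i)))} {⟦ ψ ⟧ T.ε} {0ℤ}
            (GroupHomomorphism.⟦⟧-cong ψ {⟦ torsionPart ⟧ (⟦ σ ⟧ (basis i))} {T.ε} (≗⇒≈ P (τ∘σ s (basis i))))
            (GroupHomomorphism.ε-homo ψ))
          (G.reflexive (trans (sum-cong-≗ (λ j → cong (ℤ._* v j) (π∘σ (basis i) j))) (dot-basis v i))))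
        (G.identityˡ (v i))

    -- A member of P lies in ker π, where the extension agrees with ψ, and its class in the torsion
    -- group is zero.
    extend-kills : ∀ ψ v x → P x → ⟦ extend ψ v ⟧ x G.≈ 0ℤ
    extend-kills ψ v x p = G.trans {⟦ extend ψ v ⟧ x} {⟦ ψ ⟧ t} {0ℤ} (extend-torsion ψ v t)
      (G.trans {⟦ ψ ⟧ t} {⟦ ψ ⟧ T.ε} {0ℤ}
        (GroupHomomorphism.⟦⟧-cong ψ {t} {T.ε} (Generated⇒≈ε P (gen p)))
        (GroupHomomorphism.ε-homo ψ))
      where
      t : T.Carrier
      t = x , ker-π⇒torsion P s (π-P p)

-- The characteristic quasi-polynomial

subsetoid-cong : ∀ {X} {P Q : Setoid.Carrier X → Set} →
  (∀ {x} → P x → Q x) → (∀ {x} → Q x → P x) → Inverse (subsetoid X P) (subsetoid X Q)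
subsetoid-cong {X} P⇒Q Q⇒P = mkInverse
  (λ (x , p) → x , P⇒Q p) (λ (x , p) → x , Q⇒P p) id id
  (λ _ → Setoid.refl X) (λ _ → Setoid.refl X)

eval-Σ : ∀ {I : Set} t (p : I → Polynomial) (g : I → ℤ) → (∀ i → eval (p i) t ≡ ℤ→ℚ (g i)) →
  ∀ is → eval (foldr _+ᴾ_ [] (map p is)) t ≡ ℤ→ℚ (Σᴸ g is)
eval-Σ t p g eq []       = refl
eval-Σ t p g eq (i ∷ is) = begin
  eval (p i +ᴾ foldr _+ᴾ_ [] (map p is)) t               ≡⟨ eval-+ᴾ (p i) _ t ⟩
  eval (p i) t ℚ.+ eval (foldr _+ᴾ_ [] (map p is)) t     ≡⟨ cong₂ ℚ._+_ (eq i) (eval-Σ t p g eq is) ⟩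
  ℤ→ℚ (g i) ℚ.+ ℤ→ℚ (Σᴸ g is)                          ≡⟨ ℤ→ℚ-homo-+ (g i) (Σᴸ g is) ⟨
  ℤ→ℚ (g i ℤ.+ Σᴸ g is)                                 ∎
  where open ≡-Reasoning

module _ {ℓ} (A : List (Vectorℤ ℓ)) (q : ℕ) (q≢0 : NonZero q) where
  private
    module G = AbelianGroup (ℤ/ q)

    Homs : Setoid 0ℓ 0ℓ
    Homs = HomSetoid (ℤ^ ℓ) (ℤ/ q)

    homs : Homs HasCardinality (q ℕ.^ ℓ)
    homs = Hom-ℤⁿ-cardinality q q≢0 ℓ

  Vanishes : Hom (ℤ^ ℓ) (ℤ/ q) → Fin (length A) → Set
  Vanishes φ i = ⟦ φ ⟧ (lookup A i) G.≈ 0ℤ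

  vanishes? : ∀ φ i → Dec (Vanishes φ i)
  vanishes? φ i = _≈?_ q (⟦ φ ⟧ (lookup A i)) 0ℤ

  Annihilators : Sublist A → Setoid 0ℓ 0ℓ
  Annihilators S = subsetoid Homs (λ φ → ∀ i → i ∈ˢ S → Vanishes φ i)

  -- Inclusion-exclusion holds for each φ separately. Summing over the q^ℓ homomorphisms and
  -- exchanging the two sums leaves, for each S, the number of φ that vanish on S.
  ℳ-cardinality : ∀ {N} (K : Sublist A → ℕ) → (∀ S → Annihilators S HasCardinality K S) →
    ℳ A (ℤ/ q) HasCardinality N → + N ≡ Σᴸ (λ S → sign S ℤ.* + K S) (sublists A)
  ℳ-cardinality {N} K annihilators e = begin
    + N
      ≡⟨ subset-cardinality homs
           (λ {φ} {ψ} φ≈ψ φ-avoids i ψ-vanishes → φ-avoids i (transfer {φ} {ψ} φ≈ψ i ψ-vanishes))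
           (λ φ → none? (vanishes? φ)) (Composition.inverse forget e) ⟩
    sum (λ j → indicator (does (none? (vanishes? (φ j)))))
      ≡⟨ sum-cong-≗ (λ j → inclusion-exclusion (vanishes? (φ j))) ⟩
    sum (λ j → Σᴸ (λ S → sign S ℤ.* vanishing S j) (sublists A))
      ≡⟨ sum-Σᴸ-swap (λ j S → sign S ℤ.* vanishing S j) (sublists A) ⟩
    Σᴸ (λ S → sum (λ j → sign S ℤ.* vanishing S j)) (sublists A)
      ≡⟨ Σᴸ-cong (λ S → sym (*-distribˡ-sum (sign S) (vanishing S))) (sublists A) ⟩
    Σᴸ (λ S → sign S ℤ.* sum (vanishing S)) (sublists A)
      ≡⟨ Σᴸ-cong (λ S → cong (sign S ℤ.*_) (subset-cardinality homs
           (λ {φ} {ψ} φ≈ψ φ-vanishes i i∈S → transfer {ψ} {φ} (λ x → G.sym {⟦ φ ⟧ x} {⟦ ψ ⟧ x} (φ≈ψ x)) i (φ-vanishes i i∈S))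
           (λ φ → all∈? (vanishes? φ) S) (annihilators S))) (sublists A) ⟨
    Σᴸ (λ S → sign S ℤ.* + K S) (sublists A) ∎
    where
    open ≡-Reasoning
    φ : Fin (q ℕ.^ ℓ) → Hom (ℤ^ ℓ) (ℤ/ q)
    φ = Inverse.from homs
    vanishing : Sublist A → Fin (q ℕ.^ ℓ) → ℤ
    vanishing S j = indicator (does (all∈? (vanishes? (φ j)) S))
    transfer : ∀ {φ ψ} → Setoid._≈_ Homs φ ψ → ∀ i → Vanishes ψ i → Vanishes φ i
    transfer {φ} {ψ} φ≈ψ i = G.trans {⟦ φ ⟧ (lookup A i)} {⟦ ψ ⟧ (lookup A i)} {0ℤ} (φ≈ψ (lookup A i))
    forget : Inverse (subsetoid Homs (λ φ → ∀ i → ¬ Vanishes φ i)) (ℳ A (ℤ/ q))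
    forget = mkInverse id id id id (λ (φ , _) → Setoid.refl Homs {φ}) (λ (φ , _) → Setoid.refl Homs {φ})

module _ {ℓ} (A : List (Vectorℤ ℓ)) {ρ} (period : IsLCMPeriod A ρ) (e k : ℕ)
  {{e≢0 : NonZero e}} {{k≢0 : NonZero k}} (D : CharacteristicData A (ℤ/ k)) where
  open CharacteristicData D
  private
    q = e ℕ.* k
    module G = AbelianGroup (ℤ/ q)
    T : Sublist A → Ab
    T S = Torsion (Members A S)

  -- By `Hom-splitting`, an annihilator of S is a homomorphism tor → ℤ/q together with a point of
  -- (ℤ/q)^corank. The first factor is exchanged for Hom(tor, ℤ/k), counted by `m S`; the multiplier
  -- ρ identifies the corank with ℓ - r.
  annihilators-cardinality : (j : ℕ) → q ≡ k ℕ.+ j ℕ.* ρ →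
    ∀ S → Annihilators A q (ℕ.m*n≢0 e k) S HasCardinality (m S ℕ.* q ℕ.^ (ℓ ∸ r S))
  annihilators-cardinality j q≡k+jρ S = subst (λ f → Annihilators A q (ℕ.m*n≢0 e k) S HasCardinality (m S ℕ.* q ℕ.^ f))
    (corank≡n∸rank s (r S) (r-is S) (+ ρ) ρ≢0 (λ {x} πx≗0 → period-exponent period S (x , ker-π⇒torsion _ s πx≗0)))
    (Composition.inverse (subsetoid-cong
        (λ { vanishes x (i , i∈S , refl) → vanishes i i∈S })
        (λ kills i i∈S → kills (lookup A i) (i , i∈S , refl)))
      (Composition.inverse (Hom-splitting s q)
        (cardinality-× (Composition.inverse (Hom-k-torsion e k (T S) k-torsion) (m-is S))
          (cardinality-^ (ℤ/-cardinality q (ℕ.m*n≢0 e k)) corank))))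
    where
    s = splitting A S
    open Splitting s using (corank)
    ρ≢0 : + ρ ≢ 0ℤ
    ρ≢0 ρ≡0 = ℕ.≢-nonZero⁻¹ ρ {{period-nonZero period}} (ℤ.+-injective ρ≡0)
    -- k = q - jρ, and ρ annihilates the torsion.
    k-torsion : ∀ (φ : Hom (T S) (ℤ/ q)) t → + q ∣ℤ + k ℤ.* ⟦ φ ⟧ t
    k-torsion φ t = subst (+ q ∣ℤ_) (begin
      + q ℤ.* y ℤ.- + j ℤ.* (+ ρ ℤ.* y)                      ≡⟨ cong (λ c → c ℤ.* y ℤ.- + j ℤ.* (+ ρ ℤ.* y)) expanded ⟩
      (+ k ℤ.+ + j ℤ.* + ρ) ℤ.* y ℤ.- + j ℤ.* (+ ρ ℤ.* y)    ≡⟨ cancel (+ k) (+ j) (+ ρ) y ⟩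
      + k ℤ.* y                                              ∎)
      (ℤ∣.∣m∣n⇒∣m-n (ℤ∣.∣m⇒∣m*n y ℤ∣.∣-refl) (ℤ∣.∣n⇒∣m*n (+ j) q∣ρy))
      where
      open ≡-Reasoning
      y = ⟦ φ ⟧ t
      expanded : + q ≡ + k ℤ.+ + j ℤ.* + ρ
      expanded = trans (cong +_ q≡k+jρ) (trans (ℤ.pos-+ k (j ℕ.* ρ)) (cong (λ c → + k ℤ.+ c) (ℤ.pos-* j ρ)))
      cancel : ∀ k j ρ y → (k ℤ.+ j ℤ.* ρ) ℤ.* y ℤ.- j ℤ.* (ρ ℤ.* y) ≡ k ℤ.* y
      cancel = ℤ-Solver.solve-∀
      ρt≈ε : AbelianGroup._≈_ (T S) (_·_ (T S) ρ t) (AbelianGroup.ε (T S))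
      ρt≈ε = Generated⇒≈ε (Members A S) (resp (λ i → sym (·-torsion (Members A S) ρ t i)) (period-exponent period S t))
      q∣ρy : + q ∣ℤ + ρ ℤ.* y
      q∣ρy = subst (+ q ∣ℤ_) (·-ℤ/ q ρ y) (≈0⇒∣ q (G.trans {_·_ (ℤ/ q) ρ y} {⟦ φ ⟧ (_·_ (T S) ρ t)} {0ℤ}
        (G.sym {⟦ φ ⟧ (_·_ (T S) ρ t)} {_·_ (ℤ/ q) ρ y} (hom-· (T S) (ℤ/ q) φ ρ t))
        (G.trans {⟦ φ ⟧ (_·_ (T S) ρ t)} {⟦ φ ⟧ (AbelianGroup.ε (T S))} {0ℤ}
          (GroupHomomorphism.⟦⟧-cong φ {_·_ (T S) ρ t} {AbelianGroup.ε (T S)} ρt≈ε)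
          (GroupHomomorphism.ε-homo φ))))

  ℳ-cardinality≡χ : (j : ℕ) → q ≡ k ℕ.+ j ℕ.* ρ → ∀ {N} → ℳ A (ℤ/ q) HasCardinality N →
    ℤ→ℚ (+ N) ≡ eval χ (ℤ→ℚ (+ q))
  ℳ-cardinality≡χ j q≡k+jρ {N} count = begin
    ℤ→ℚ (+ N)
      ≡⟨ cong ℤ→ℚ (ℳ-cardinality A q (ℕ.m*n≢0 e k) _ (annihilators-cardinality j q≡k+jρ) count) ⟩
    ℤ→ℚ (Σᴸ (λ S → sign S ℤ.* + (m S ℕ.* q ℕ.^ (ℓ ∸ r S))) (sublists A))
      ≡⟨ eval-Σ (ℤ→ℚ (+ q)) _ (λ S → sign S ℤ.* + (m S ℕ.* q ℕ.^ (ℓ ∸ r S)))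
           (λ S → trans (eval-monomial (sign S ℤ.* + m S) (ℓ ∸ r S) q) (cong ℤ→ℚ (regroup S))) (sublists A) ⟨
    eval χ (ℤ→ℚ (+ q)) ∎
    where
    open ≡-Reasoning
    regroup : ∀ S → (sign S ℤ.* + m S) ℤ.* + (q ℕ.^ (ℓ ∸ r S)) ≡ sign S ℤ.* + (m S ℕ.* q ℕ.^ (ℓ ∸ r S))
    regroup S = trans (ℤ.*-assoc (sign S) (+ m S) _) (cong (sign S ℤ.*_) (sym (ℤ.pos-* (m S) _)))

mainTheorem11 : (ℓ : ℕ) (A : List (AbelianGroup.Carrier (ℤ^ ℓ))) →
    (ρ : ℕ) → IsLCMPeriod A ρ →
    (k : ℕ) → NonZero k → k ∣ ρ →
    (f : Polynomial) → IsConstituent A ρ k f →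
    (D : CharacteristicData A (ℤ/ k)) →
    f ≋ CharacteristicData.χ D
mainTheorem11 ℓ A ρ period k k≢0 (divides d ρ≡d*k) f constituent D =
  agreement⇒≋ f χ (λ j → ℤ→ℚ (+ q j)) q-injective agree
  where
  open CharacteristicData D using (χ)
  open ≡-Reasoning
  instance
    _ = k≢0
    _ = period-nonZero period
  -- As ρ = d k, this is k + jρ written as a multiple of k, so that e = 1 + j d can serve as the
  -- embedding factor. The `suc` keeps e nonzero even for j = 0, where q = k.
  q : ℕ → ℕ
  q j = suc (j ℕ.* d) ℕ.* k
  q≡k+jρ : ∀ j → q j ≡ k ℕ.+ j ℕ.* ρ
  q≡k+jρ j = cong (k ℕ.+_) (trans (ℕ.*-assoc j d k) (cong (j ℕ.*_) (sym ρ≡d*k)))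
  q-injective : ∀ {i j} → ℤ→ℚ (+ q i) ≡ ℤ→ℚ (+ q j) → i ≡ j
  q-injective {i} {j} eq = ℕ.*-cancelʳ-≡ i j ρ (ℕ.+-cancelˡ-≡ k (i ℕ.* ρ) (j ℕ.* ρ)
    (trans (sym (q≡k+jρ i)) (trans (ℤ.+-injective (ℤ→ℚ-injective eq)) (q≡k+jρ j))))
  q≡k[ρ] : ∀ j → ρ ∣ ℕ.∣ q j - k ∣
  q≡k[ρ] j = divides j (begin
    ℕ.∣ q j - k ∣              ≡⟨ cong ℕ.∣_- k ∣ (q≡k+jρ j) ⟩
    ℕ.∣ k ℕ.+ j ℕ.* ρ - k ∣    ≡⟨ ℕ.∣-∣-comm (k ℕ.+ j ℕ.* ρ) k ⟩
    ℕ.∣ k - k ℕ.+ j ℕ.* ρ ∣    ≡⟨ ℕ.∣m-m+n∣≡n k (j ℕ.* ρ) ⟩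
    j ℕ.* ρ                    ∎)
  agree : ∀ j → eval f (ℤ→ℚ (+ q j)) ≡ eval χ (ℤ→ℚ (+ q j))
  agree j with constituent (q j) (ℕ.m*n≢0 (suc (j ℕ.* d)) k) (q≡k[ρ] j)
  ... | N , count , f[q]≡N = trans f[q]≡N (ℳ-cardinality≡χ A period (suc (j ℕ.* d)) k D j (q≡k+jρ j) count)
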